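{- Let $\mathcal{H}=\{rrr,rrb,bby\}$. Then, as $n\to\infty$, $h_2(n,\mathcal{H})=\Omega(\sqrt{n\log n})$ and $h_2(n,\mathcal{H})=O(n^{2/3}\sqrt{\log n})$.
   Context: Edge-colorings of the complete graph $K_n$ use colors from $\{r,b,y\}$ (red, blue, yellow); they need not be proper, and not all colors need be used. A pattern is an edge-colored triangle, denoted by the multiset of the colors of its three edges; e.g. $rrr$ is the all-red triangle, $rrb$ is the triangle with two red edges and one blue edge, and $bby$ has two blue edges and one yellow edge. For a family $\mathcal{H}$ of patterns, $\operatorname{Forb}(n,\mathcal{H})$ is the set of all edge-colorings of $K_n$ with colors from $\{r,b,y\}$ in which no triangle has a coloring belonging to $\mathcal{H}$. For an edge-coloring $c$ of $K_n$, $h_2(c)$ is the maximum $k$ such that there is a set of $k$ vertices whose induced edges use at most two of the three colors. Finally, $h_2(n,\mathcal{H})=\min\{h_2(c): c\in\operatorname{Forb}(n,\mathcal{H})\}$. Here $\log$ is the base-2 logarithm. -}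

module Defs where

open import Algebra.Definitions.RawSemiring using (_^_)
open import Data.Fin using (Fin)
open import Data.Fin.Subset using (Subset; ∣_∣) renaming (_∈_ to _∈ₛ_)
open import Data.Integer using (+_) renaming (∣_∣ to abs)
open import Data.List using (List; []; _∷_)
open import Data.List.Membership.Propositional using (_∈_)
open import Data.List.Relation.Binary.Permutation.Propositional using (_↭_)
open import Data.Nat as ℕ using (ℕ; NonZero)
open import Data.Product using (Σ-syntax; ∃-syntax; _×_)
open import Data.Rational as ℚ using (ℚ; 0ℚ; Positive; ↥_; ↧ₙ_; _/_)
open import Data.Sum using (_⊎_)
open import Data.Vec as Vec using (Vec; []; _∷_)
open import Level using (0ℓ)
open import Relation.Binary.PropositionalEquality using (_≡_; _≢_)
open import Relation.Nullary using (¬_)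
open import Relation.Unary using (Pred; _⊆_)

data Color : Set where
  r b y : Color

-- Edge-colorings of Kₙ.  The values on the diagonal carry no meaning, and
-- every definition below only looks at pairs of distinct vertices.
record Coloring (n : ℕ) : Set where
  field
    color : Fin n → Fin n → Color
    color-sym : ∀ u v → color u v ≡ color v u

open Coloring public

-- Multisets of three colors: patterns are only ever compared up to _↭_.
Pattern : Set
Pattern = Vec Color 3

Triangle-has : ∀ {n} → Coloring n → (u v w : Fin n) → Pattern → Set
Triangle-has c u v w p =
  (color c u v ∷ color c v w ∷ color c u w ∷ []) ↭ Vec.toList p

Forb : (n : ℕ) → List Pattern → Pred (Coloring n) 0ℓ
Forb n ℋ c = ∀ u v w → u ≢ v → v ≢ w → u ≢ w →
             ∀ p → p ∈ ℋ → ¬ Triangle-has c u v w p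

-- Taking x = z covers the case of a single color.
UsesAtMostTwoColors : ∀ {n} → Coloring n → Subset n → Set
UsesAtMostTwoColors c S =
  ∃[ x ] ∃[ z ] (∀ u v → u ∈ₛ S → v ∈ₛ S → u ≢ v →
                 color c u v ≡ x ⊎ color c u v ≡ z)

IsMaximum IsMinimum : Pred ℕ 0ℓ → Pred ℕ 0ℓ
IsMaximum P m = P m × (∀ k → P k → k ℕ.≤ m)
IsMinimum P m = P m × (∀ k → P k → m ℕ.≤ k)

-- IsH₂Of c k says h₂(c) = k.
IsH₂Of : ∀ {n} → Coloring n → Pred ℕ 0ℓ
IsH₂Of {n} c =
  IsMaximum (λ k → Σ[ S ∈ Subset n ] (∣ S ∣ ≡ k × UsesAtMostTwoColors c S))

-- IsH₂ n ℋ m says h₂(n,ℋ) = m.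
IsH₂ : (n : ℕ) → List Pattern → Pred ℕ 0ℓ
IsH₂ n ℋ = IsMinimum (λ k → Σ[ c ∈ Coloring n ] (Forb n ℋ c × IsH₂Of c k))

rrr-rrb-bby : List Pattern
rrr-rrb-bby = (r ∷ r ∷ r ∷ []) ∷ (r ∷ r ∷ b ∷ []) ∷ (b ∷ b ∷ y ∷ []) ∷ []

-- A nonnegative real x is represented by the open lower Dedekind cut
-- { q ∈ ℚ | 0 ≤ q < x }; in particular 0 is the empty cut.
ℝ≥0 : Set₁
ℝ≥0 = Pred ℚ 0ℓ

fromℚ : ℚ → ℝ≥0
fromℚ x q = 0ℚ ℚ.≤ q × q ℚ.< x

fromℕ : ℕ → ℝ≥0
fromℕ n = fromℚ (+ n / 1)

infix 4 _≤ᵣ_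
_≤ᵣ_ : ℝ≥0 → ℝ≥0 → Set
x ≤ᵣ z = x ⊆ z

infixl 7 _·_
_·_ : ℝ≥0 → ℝ≥0 → ℝ≥0
(x · z) q = 0ℚ ℚ.≤ q × (∃[ s ] ∃[ t ] (x s × z t × q ℚ.≤ s ℚ.* t))

-- The k-th root of x: q < x^(1/k) iff q^k < x.
root : (k : ℕ) → .{{NonZero k}} → ℝ≥0 → ℝ≥0
root k x q = 0ℚ ℚ.≤ q × x (_^_ ℚ.+-*-rawSemiring q k)

√_ : ℝ≥0 → ℝ≥0
√_ = root 2

-- The base-2 logarithm of n ≥ 1: for q = a/d ≥ 0 in lowest terms,
-- q < log₂ n iff 2^a < n^d.  (For n = 0 this gives the junk value 0.)
log : ℕ → ℝ≥0
log n q = 0ℚ ℚ.≤ q × 2 ℕ.^ abs (↥ q) ℕ.< n ℕ.^ (↧ₙ q)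

_^2/3 : ℕ → ℝ≥0
n ^2/3 = root 3 (fromℕ (n ℕ.^ 2))

-- f = Ω(g) and f = O(g) as n → ∞.  Rational constants suffice, as every
-- positive real lies between two positive rationals.
_isΩ_ _isO_ : (ℕ → ℕ) → (ℕ → ℝ≥0) → Set
f isΩ g = Σ[ c ∈ ℚ ] (Positive c ×
  (Σ[ N ∈ ℕ ] (∀ n → N ℕ.≤ n → fromℚ c · g n ≤ᵣ fromℕ (f n))))
f isO g = Σ[ C ∈ ℚ ] (Positive C ×
  (Σ[ N ∈ ℕ ] (∀ n → N ℕ.≤ n → fromℕ (f n) ≤ᵣ fromℚ C · g n)))

{-# OPTIONS --safe #-}

{-
Lower bound.  If c avoids the three patterns then the red graph is triangle-free
and every red neighbourhood is a yellow clique, so red degrees are at most h₂(c);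
red-independent sets use only blue and yellow, so they too have at most h₂(c)
vertices.  Alon's argument for triangle-free graphs (look at a uniformly random
independent set W, and resample W on v and its neighbours) shows n l ≤ 4 d α
whenever 4^l ≤ d, where d bounds the degrees and α the independent sets.  With l
of order log n this reads n log n = O(h₂(c)²).

Upper bound.  Take a prime q of order n^(1/3) and let the vertices be n flags of the
affine plane over 𝔽_q: a point (x , z) together with a line of slope m through it.
Flags with the same x and the same m are joined in blue.  Flags with x < x′, with
m ≠ m′, and with the point (x , z) on the line of the second flag are joined in
red, and all other pairs in yellow.  This coloring avoids the patterns because two
points lie on at most one common line.  Two-colored sets have at most 2 q²
vertices; the main case is a set without red edges, where a flag which is not the
last one of the set on its line is the only one of the set at its point.

The prime is found by Chebyshev's method: without primes in (x , 16 x], the numbers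
up to 16 x would have a common multiple smaller than 2^(16 x - 1), but the
divisibilities (n + 1) C(n , k) ∣ lcm(1 , … , n + 1) forbid this.
-}
module Submission where

open import Defs
open import Data.Fin as Fin using (Fin; toℕ; fromℕ<; combine; inject≤; remQuot; finToFun; funToFin) renaming (_<_ to _<ᶠ_)
open import Data.Fin.Properties as Fin using (toℕ-injective; toℕ<n; toℕ-fromℕ<; injective⇒≤; combine-injective; any?; all?; finToFun-funToFin; remQuot-combine)
open import Data.Fin.Subset using (Subset; inside; outside; ∣_∣) renaming (_∈_ to _∈ₛ_; ⊥ to ⊥ₛ)
open import Data.Fin.Subset.Properties using (nonempty?; _∈?_; anySubset?; ∣p∣≤n; ∣⊥∣≡0; ∉⊥)
open import Data.Empty using (⊥; ⊥-elim)
open import Data.Integer as ℤ using (ℤ; +_; -[1+_]; +≤+; -≤+; +<+)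
open import Data.Integer.Divisibility.Signed as ℤ∣ using () renaming (_∣_ to _∣ℤ_)
import Data.Integer.Properties as ℤ
import Data.Integer.Tactic.RingSolver as ℤ-Ring
open import Data.List using (List; []; _∷_; _++_; length; filter; allFin)
open import Data.List.Membership.Propositional using (_∈_)
open import Data.List.Membership.Propositional.Properties using (∈-∃++; ∈-allFin; ∈-filter⁺; ∈-filter⁻)
open import Data.List.Properties using (length-tabulate)
open import Data.List.Relation.Binary.Permutation.Propositional as Perm using (_↭_; ↭-sym; ↭-trans; prep; swap)
open import Data.List.Relation.Binary.Permutation.Propositional.Properties using (All-resp-↭; ∈-resp-↭; drop-∷; shift; ++⁺ʳ)
open import Data.List.Relation.Unary.All as All using (All; []; _∷_)
open import Data.List.Relation.Unary.All.Properties using (all-filter)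
open import Data.List.Relation.Unary.AllPairs using (AllPairs; []; _∷_)
open import Data.List.Relation.Unary.Any using (here; there)
open import Data.List.Relation.Unary.Unique.Propositional using (Unique)
open import Data.List.Relation.Unary.Unique.Propositional.Properties using (allFin⁺; filter⁺)
open import Data.Nat
open import Data.Nat.Combinatorics using (_C_; nCk+nC[k+1]≡[n+1]C[k+1]; k>n⇒nCk≡0; nCk≡n!/k![n-k]!; k![n∸k]!∣n!)
import Data.Nat.Coprimality as Coprime
open import Data.Nat.Divisibility
open import Data.Nat.DivMod using (m≡m%n+[m/n]*n; m%n<n; m/n*n≡m; /-congʳ)
open import Data.Nat.Induction using (<-rec)
open import Data.Nat.Primality using (Prime; prime?; euclidsLemma; prime⇒nonTrivial; prime⇒nonZero; ¬prime[1])
open import Data.Nat.Primality.Factorisation using (factorise)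
open import Data.Nat.Properties
open import Data.Nat.Tactic.RingSolver using (solve-∀)
open import Data.Product using (Σ-syntax; ∃-syntax; _×_; _,_; proj₁; proj₂)
import Data.Product.Properties as Product
open import Data.Rational as ℚ using (ℚ; mkℚ; 0ℚ; 1ℚ; *≤*; *<*)
import Data.Rational.Properties as ℚ
open import Data.Rational.Unnormalised using (*≡*)
import Data.Rational.Unnormalised.Properties as ℚᵘ
open import Data.Sum as Sum using (_⊎_; inj₁; inj₂; [_,_]′)
open import Data.Vec using ([]; _∷_; here; there)
open import Level using (0ℓ)
open import Relation.Binary.Definitions using (tri<; tri≈; tri>)
open import Relation.Binary.PropositionalEquality hiding ([_])
open import Relation.Nullary using (¬_; Dec; yes; no; contradiction)
open import Relation.Nullary.Decidable using (_×-dec_; _⊎-dec_; _→-dec_; ¬?; map′)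
open import Relation.Unary using (Pred; Decidable)

-- Common multiples of 1, …, n + 1

-- Together with Pascal's rule this gives the reciprocal identity of Leibniz's harmonic triangle
-- used in `leibniz-∣`.
binomial-absorption : ∀ n k → suc k * (suc n C suc k) ≡ suc n * (n C k)
binomial-absorption zero zero = refl
binomial-absorption zero (suc k) = begin
  suc (suc k) * (1 C suc (suc k)) ≡⟨ cong (suc (suc k) *_) (k>n⇒nCk≡0 {1} {2 + k} (s<s (s≤s z≤n))) ⟩
  suc (suc k) * 0                 ≡⟨ *-zeroʳ (suc (suc k)) ⟩
  0                               ≡⟨ cong (1 *_) (k>n⇒nCk≡0 {0} {suc k} (s≤s z≤n)) ⟨
  1 * (0 C suc k)                 ∎
  where open ≡-Reasoning
binomial-absorption (suc n) zero = begin
  1 * (suc (suc n) C 1)           ≡⟨ cong (1 *_) (nCk+nC[k+1]≡[n+1]C[k+1] (suc n) 0) ⟨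
  1 * (1 + (suc n C 1))           ≡⟨ cong (λ ● → 1 * (1 + ●)) (sym (*-identityˡ (suc n C 1))) ⟩
  1 * (1 + 1 * (suc n C 1))       ≡⟨ cong (λ ● → 1 * (1 + ●)) (binomial-absorption n zero) ⟩
  1 * (1 + suc n * 1)             ≡⟨ lemma n ⟩
  suc (suc n) * 1                 ∎
  where
  open ≡-Reasoning
  lemma : ∀ m → 1 * (1 + suc m * 1) ≡ suc (suc m) * 1
  lemma = solve-∀
binomial-absorption (suc n) (suc k) = begin
  (2 + k) * ((2 + n) C (2 + k))
    ≡⟨ cong ((2 + k) *_) (nCk+nC[k+1]≡[n+1]C[k+1] (suc n) (suc k)) ⟨
  (2 + k) * (C₁ + C₂)
    ≡⟨ split k C₁ C₂ ⟩
  C₁ + suc k * C₁ + (2 + k) * C₂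
    ≡⟨ cong₂ (λ u v → C₁ + u + v) (binomial-absorption n k) (binomial-absorption n (suc k)) ⟩
  C₁ + suc n * (n C k) + suc n * (n C suc k)
    ≡⟨ merge n C₁ (n C k) (n C suc k) ⟩
  C₁ + suc n * ((n C k) + (n C suc k))
    ≡⟨ cong (λ ● → C₁ + suc n * ●) (nCk+nC[k+1]≡[n+1]C[k+1] n k) ⟩
  (2 + n) * C₁ ∎
  where
  open ≡-Reasoning
  C₁ = suc n C suc k
  C₂ = suc n C suc (suc k)
  split : ∀ k p q → (2 + k) * (p + q) ≡ p + suc k * p + (2 + k) * q
  split = solve-∀
  merge : ∀ n p q s → p + suc n * q + suc n * s ≡ p + suc n * (q + s)
  merge = solve-∀

binomialSum : ℕ → ℕ → ℕ
binomialSum n zero    = 0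
binomialSum n (suc k) = binomialSum n k + (n C k)

binomialSum-pascal : ∀ n k →
  binomialSum (suc n) (suc k) ≡ binomialSum n k + binomialSum n (suc k)
binomialSum-pascal n zero = refl
binomialSum-pascal n (suc k) = begin
  binomialSum (suc n) (suc k) + (suc n C suc k)
    ≡⟨ cong₂ _+_ (binomialSum-pascal n k) (sym (nCk+nC[k+1]≡[n+1]C[k+1] n k)) ⟩
  s + (s + (n C k)) + ((n C k) + (n C suc k))
    ≡⟨ lemma s (n C k) (n C suc k) ⟩
  s + (n C k) + (s + (n C k) + (n C suc k)) ∎
  where
  open ≡-Reasoning
  s = binomialSum n k
  lemma : ∀ s p q → s + (s + p) + (p + q) ≡ s + p + (s + p + q)
  lemma = solve-∀

binomialSum-row : ∀ n → binomialSum n (suc n) ≡ 2 ^ n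
binomialSum-row zero = refl
binomialSum-row (suc n) = begin
  binomialSum (suc n) (2 + n)                   ≡⟨ binomialSum-pascal n (suc n) ⟩
  S + (S + (n C suc n))                         ≡⟨ cong (λ ● → S + (S + ●)) (k>n⇒nCk≡0 (n<1+n n)) ⟩
  S + (S + 0)                                   ≡⟨ cong (λ ● → ● + (● + 0)) (binomialSum-row n) ⟩
  2 ^ suc n                                     ∎
  where
  open ≡-Reasoning
  S = binomialSum n (suc n)

binomialSum-≥ : ∀ n {j k} → j < k → n C j ≤ binomialSum n k
binomialSum-≥ n {j} {suc k} j<1+k with m≤n⇒m<n∨m≡n (≤-pred j<1+k)
... | inj₁ j<k  = ≤-trans (binomialSum-≥ n j<k) (m≤m+n _ _)
... | inj₂ refl = m≤n+m _ _

binomial≤2^n : ∀ n {k} → k ≤ n → n C k ≤ 2 ^ n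
binomial≤2^n n k≤n = ≤-trans (binomialSum-≥ n (s≤s k≤n)) (≤-reflexive (binomialSum-row n))

*-binomialSum-≤ : ∀ c n k {B} → (∀ j → c * (n C j) ≤ B) → c * binomialSum n k ≤ k * B
*-binomialSum-≤ c n zero h = ≤-reflexive (*-zeroʳ c)
*-binomialSum-≤ c n (suc k) {B} h = begin
  c * (binomialSum n k + (n C k))   ≡⟨ *-distribˡ-+ c (binomialSum n k) (n C k) ⟩
  c * binomialSum n k + c * (n C k) ≤⟨ +-mono-≤ (*-binomialSum-≤ c n k h) (h k) ⟩
  k * B + B                         ≡⟨ +-comm (k * B) B ⟩
  B + k * B                         ∎
  where open ≤-Reasoning

-- This is 1/a = 1/u − 1/v with denominators cleared: it makes a a divisor of
-- every common multiple of u and v.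
harmonic-∣ : ∀ a u v {M} .{{_ : NonZero a}} .{{_ : NonZero u}} .{{_ : NonZero v}} →
             a * v ≡ u * v + a * u → u ∣ M → v ∣ M → a ∣ M
harmonic-∣ a u v {M} eq (divides s M≡su) (divides t M≡tv) =
  ∣m+n∣m⇒∣n (divides s (*-cancelʳ-≡ (t * a + M) (s * a) v key)) (n∣m*n t)
  where
  open ≡-Reasoning
  instance _ = m*n≢0 u v
  key : (t * a + M) * v ≡ s * a * v
  key = begin
    (t * a + M) * v       ≡⟨ e₁ t a v M ⟩
    a * (t * v) + M * v   ≡⟨ cong₂ (λ p q → a * p + q * v) (trans (sym M≡tv) M≡su) M≡su ⟩
    a * (s * u) + s * u * v ≡⟨ e₂ a s u v ⟩
    s * (u * v + a * u)   ≡⟨ cong (s *_) eq ⟨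
    s * (a * v)           ≡⟨ *-assoc s a v ⟨
    s * a * v             ∎
    where
    e₁ : ∀ t a v M → (t * a + M) * v ≡ a * (t * v) + M * v
    e₁ = solve-∀
    e₂ : ∀ a s u v → a * (s * u) + s * u * v ≡ s * (u * v + a * u)
    e₂ = solve-∀

binomial-nonZero : ∀ n k → k ≤ n → NonZero (n C k)
binomial-nonZero n zero _ = _
binomial-nonZero (suc n) (suc k) (s≤s k≤n) =
  subst NonZero (nCk+nC[k+1]≡[n+1]C[k+1] n k)
    (>-nonZero (<-≤-trans (>-nonZero⁻¹ (n C k) {{binomial-nonZero n k k≤n}}) (m≤m+n _ _)))

-- The numbers `suc n * (n C k)` are the denominators of Leibniz's harmonic triangle. Column 0 is
-- the hypothesis, and each later entry satisfies 1/a = 1/u - 1/v, with u one row above and v beside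
-- it, both in the previous column, so `harmonic-∣` carries divisibility from column to column.
leibniz-∣ : ∀ {M T} → (∀ j → 1 ≤ j → j ≤ T → j ∣ M) →
            ∀ n k → k ≤ n → suc n ≤ T → suc n * (n C k) ∣ M
leibniz-∣ {M} h n zero _ 1+n≤T = subst (_∣ M) (sym (*-identityʳ (suc n))) (h (suc n) (s≤s z≤n) 1+n≤T)
leibniz-∣ {M} h (suc n) (suc k) (s≤s k≤n) 2+n≤T =
  harmonic-∣ a u v eq
    (leibniz-∣ h n k k≤n (<⇒≤ 2+n≤T))
    (leibniz-∣ h (suc n) k (m≤n⇒m≤1+n k≤n) 2+n≤T)
  where
  c c₀ c₁ c₂ a u v : ℕ
  c = n C k
  c₀ = suc n C k
  c₁ = suc n C suc k
  c₂ = suc (suc n) C suc k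
  a = suc (suc n) * c₁
  u = suc n * c
  v = suc (suc n) * c₀
  instance
    _ = binomial-nonZero n k k≤n
    _ = binomial-nonZero (suc n) (suc k) (s≤s k≤n)
    _ = binomial-nonZero (suc n) k (m≤n⇒m≤1+n k≤n)
    a≢0 = m*n≢0 (suc (suc n)) c₁
    u≢0 = m*n≢0 (suc n) c
    v≢0 = m*n≢0 (suc (suc n)) c₀
  open ≡-Reasoning
  e₁ : ∀ n k c c₁ c₀ → suc k * ((2 + n) * c₁ * ((2 + n) * c₀)) ≡ (2 + n) * (suc k * c₁) * ((2 + n) * c₀)
  e₁ = solve-∀
  e₂ : ∀ n k c c₂ → (2 + n) * (suc n * c) * (suc k * c₂) ≡ suc k * ((2 + n) * (suc n * c) * c₂)
  e₂ = solve-∀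
  e₃ : ∀ n c c₀ c₁ → (2 + n) * (suc n * c) * (c₀ + c₁) ≡ suc n * c * ((2 + n) * c₀) + (2 + n) * c₁ * (suc n * c)
  e₃ = solve-∀
  eq : a * v ≡ u * v + a * u
  eq = *-cancelˡ-≡ (a * v) (u * v + a * u) (suc k) (begin
    suc k * (a * v)
      ≡⟨ e₁ n k c c₁ c₀ ⟩
    (2 + n) * (suc k * c₁) * ((2 + n) * c₀)
      ≡⟨ cong₂ (λ p q → (2 + n) * p * q) (binomial-absorption n k) (sym (binomial-absorption (suc n) k)) ⟩
    (2 + n) * (suc n * c) * (suc k * c₂)
      ≡⟨ e₂ n k c c₂ ⟩
    suc k * ((2 + n) * (suc n * c) * c₂)
      ≡⟨ cong (λ ● → suc k * ((2 + n) * (suc n * c) * ●)) (nCk+nC[k+1]≡[n+1]C[k+1] (suc n) k) ⟨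
    suc k * ((2 + n) * (suc n * c) * (c₀ + c₁))
      ≡⟨ cong (suc k *_) (e₃ n c c₀ c₁) ⟩
    suc k * (u * v + a * u) ∎)

-- Each `suc n * (n C j)` divides `M` and so is at most `M`; adding this up over the `suc n` entries
-- of the row, whose sum is `2 ^ n`, leaves a factor `suc n` to cancel.
commonMultiple-≥2^n : ∀ {M} n .{{_ : NonZero M}} → (∀ j → 1 ≤ j → j ≤ suc n → j ∣ M) → 2 ^ n ≤ M
commonMultiple-≥2^n {M} n h = *-cancelˡ-≤ (suc n) (begin
  suc n * 2 ^ n                   ≡⟨ cong (suc n *_) (binomialSum-row n) ⟨
  suc n * binomialSum n (suc n)   ≤⟨ *-binomialSum-≤ (suc n) n (suc n) bound ⟩
  suc n * M                       ∎)
  where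
  open ≤-Reasoning
  bound : ∀ j → suc n * (n C j) ≤ M
  bound j with j ≤? n
  ... | yes j≤n = ∣⇒≤ (leibniz-∣ h n j j≤n ≤-refl)
  ... | no  j≰n = begin
    suc n * (n C j) ≡⟨ cong (suc n *_) (k>n⇒nCk≡0 (≰⇒> j≰n)) ⟩
    suc n * 0       ≡⟨ *-zeroʳ (suc n) ⟩
    0               ≤⟨ z≤n ⟩
    M               ∎

-- Chebyshev's theorem

-- ∏ G lo len is the product of G j over lo < j ≤ lo + len.
∏ : (ℕ → ℕ) → ℕ → ℕ → ℕ
∏ G lo zero      = 1
∏ G lo (suc len) = ∏ G lo len * G (suc (lo + len))

∏-split : ∀ G lo m n → ∏ G lo (m + n) ≡ ∏ G lo m * ∏ G (lo + m) n
∏-split G lo m zero = trans (cong (∏ G lo) (+-identityʳ m)) (sym (*-identityʳ _))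
∏-split G lo m (suc n) = begin
  ∏ G lo (m + suc n)                                  ≡⟨ cong (∏ G lo) (+-suc m n) ⟩
  ∏ G lo (m + n) * G (suc (lo + (m + n)))             ≡⟨ cong₂ _*_ (∏-split G lo m n) (cong (λ ● → G (suc ●)) (sym (+-assoc lo m n))) ⟩
  ∏ G lo m * ∏ G (lo + m) n * G (suc (lo + m + n))    ≡⟨ *-assoc (∏ G lo m) _ _ ⟩
  ∏ G lo m * ∏ G (lo + m) (suc n)                     ∎
  where open ≡-Reasoning

∏-∣ : ∀ G lo len {j} → lo < j → j ≤ lo + len → G j ∣ ∏ G lo len
∏-∣ G lo zero lo<j j≤ = contradiction (≤-trans j≤ (≤-reflexive (+-identityʳ lo))) (<⇒≱ lo<j)
∏-∣ G lo (suc len) {j} lo<j j≤ with m≤n⇒m<n∨m≡n (≤-trans j≤ (≤-reflexive (+-suc lo len)))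
... | inj₁ j<  = ∣-trans (∏-∣ G lo len lo<j (≤-pred j<)) (m∣m*n _)
... | inj₂ refl = n∣m*n (∏ G lo len)

∏-mono-≤ : ∀ {G H} lo len → (∀ j → lo < j → j ≤ lo + len → G j ≤ H j) → ∏ G lo len ≤ ∏ H lo len
∏-mono-≤ lo zero h = ≤-refl
∏-mono-≤ lo (suc len) h = *-mono-≤
  (∏-mono-≤ lo len λ j lo<j j≤ → h j lo<j (≤-trans j≤ (+-monoʳ-≤ lo (n≤1+n len))))
  (h _ (s≤s (m≤m+n lo len)) (≤-reflexive (sym (+-suc lo len))))

∏-const : ∀ B lo len → ∏ (λ _ → B) lo len ≡ B ^ len
∏-const B lo zero = refl
∏-const B lo (suc len) = trans (cong (_* B) (∏-const B lo len)) (*-comm (B ^ len) B)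

∏-≥1 : ∀ {G} lo len → (∀ j → 1 ≤ j → 1 ≤ G j) → 1 ≤ ∏ G lo len
∏-≥1 lo zero h = ≤-refl
∏-≥1 lo (suc len) h = *-mono-≤ (∏-≥1 lo len h) (h _ (s≤s z≤n))

prime-∣-∏ : ∀ {p} G lo len → Prime p → p ∣ ∏ G lo len → ∃[ j ] (lo < j × j ≤ lo + len × p ∣ G j)
prime-∣-∏ G lo zero pr p∣1 = contradiction (subst Prime (∣1⇒≡1 p∣1) pr) ¬prime[1]
prime-∣-∏ G lo (suc len) pr p∣ with euclidsLemma (∏ G lo len) _ pr p∣
... | inj₂ p∣G = _ , s≤s (m≤m+n lo len) , ≤-reflexive (sym (+-suc lo len)) , p∣G
... | inj₁ p∣∏ with j , lo<j , j≤ , p∣G ← prime-∣-∏ G lo len pr p∣∏ =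
  j , lo<j , ≤-trans j≤ (+-monoʳ-≤ lo (n≤1+n len)) , p∣G

-- Divisibility by prime powers

prime≥2 : ∀ {p} → Prime p → 2 ≤ p
prime≥2 pr = nonTrivial⇒n>1 _ {{prime⇒nonTrivial pr}}

prime-power-∣ : ∀ {p m} → Prime p → ¬ (p ∣ m) → ∀ a c → p ^ a ∣ c * m → p ^ a ∣ c
prime-power-∣ pr p∤m zero c _ = 1∣ c
prime-power-∣ {p} {m} pr p∤m (suc a) c d with euclidsLemma c m pr (∣-trans (m∣m*n (p ^ a)) d)
... | inj₂ p∣m = contradiction p∣m p∤m
... | inj₁ (divides c′ refl) =
  subst (p ^ suc a ∣_) (*-comm p c′) (*-monoʳ-∣ p (prime-power-∣ pr p∤m a c′
    (*-cancelˡ-∣ p (subst (p ^ suc a ∣_) eq d))))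
  where
  instance _ = prime⇒nonZero pr
  eq : c′ * p * m ≡ p * (c′ * m)
  eq = trans (cong (_* m) (*-comm c′ p)) (*-assoc p c′ m)

prime-power-*-∣ : ∀ {p m M} → Prime p → ¬ (p ∣ m) → ∀ a → p ^ a ∣ M → m ∣ M → p ^ a * m ∣ M
prime-power-*-∣ {p} {m} pr p∤m a pᵃ∣M (divides c refl) = *-monoˡ-∣ m (prime-power-∣ pr p∤m a c pᵃ∣M)

prime-part : ∀ {p} → Prime p → ∀ k → 1 ≤ k → ∃[ a ] ∃[ m ] (k ≡ p ^ a * m × ¬ (p ∣ m))
prime-part {p} pr = <-rec _ go
  where
  go : ∀ k → (∀ {j} → j < k → 1 ≤ j → ∃[ a ] ∃[ m ] (j ≡ p ^ a * m × ¬ (p ∣ m))) →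
       1 ≤ k → ∃[ a ] ∃[ m ] (k ≡ p ^ a * m × ¬ (p ∣ m))
  go k ih 1≤k with p ∣? k
  ... | no p∤k = 0 , k , sym (+-identityʳ k) , p∤k
  ... | yes (divides (suc j) refl) with a , m , eq , p∤m ← ih {suc j} (m<m*n (suc j) p (prime≥2 pr)) (s≤s z≤n) =
    suc a , m , trans (cong (_* p) eq) (trans (*-comm _ p) (sym (*-assoc p _ m))) , p∤m

prime-divisor : ∀ k → 2 ≤ k → ∃[ p ] (Prime p × p ∣ k)
prime-divisor k@(suc _) 2≤k with factorise k
... | record { factors = [] ; isFactorisation = eq } = contradiction (≤-trans 2≤k (≤-reflexive eq)) λ { (s≤s ()) }
... | record { factors = p ∷ ps ; isFactorisation = eq ; factorsPrime = pr ∷ _ } =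
  p , pr , subst (p ∣_) (sym eq) (m∣m*n _)

-- Strong induction on `k`: splitting off the full power of one prime divisor leaves a smaller
-- cofactor not divisible by that prime, and the two divisors of `M` can be multiplied.
commonMultiple : ∀ {M n} → (∀ p a → Prime p → 1 ≤ a → p ^ a ≤ n → p ^ a ∣ M) →
                 ∀ k → 1 ≤ k → k ≤ n → k ∣ M
commonMultiple {M} {n} h = <-rec _ go
  where
  go : ∀ k → (∀ {j} → j < k → 1 ≤ j → j ≤ n → j ∣ M) → 1 ≤ k → k ≤ n → k ∣ M
  go k ih 1≤k k≤n with m≤n⇒m<n∨m≡n 1≤k
  ... | inj₂ refl = 1∣ M
  ... | inj₁ 2≤k with p , pr , p∣k ← prime-divisor k 2≤k with prime-part pr k 1≤k
  ...   | zero , m , eq , p∤m = contradiction (subst (p ∣_) (trans eq (+-identityʳ m)) p∣k) p∤m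
  ...   | suc a , zero , eq , p∤m = contradiction (_ ∣0) p∤m
  ...   | suc a , m@(suc _) , refl , p∤m = prime-power-*-∣ pr p∤m (suc a)
            (h p (suc a) pr (s≤s z≤n) (≤-trans (m≤m*n (p ^ suc a) m) k≤n))
            (ih (subst (m <_) (*-comm m (p ^ suc a)) (m<m*n m (p ^ suc a) (≤-trans (prime≥2 pr) (m≤m*n p (p ^ a))))) (s≤s z≤n) (≤-trans (m≤n*m m (p ^ suc a)) k≤n))
    where
    instance
      _ = prime⇒nonZero pr
      pᵃ≢0 = m^n≢0 p a
      pᵃ⁺¹≢0 = m^n≢0 p (suc a)

-- Products of the primes in an interval

primeOr1 : ℕ → ℕ
primeOr1 j with prime? j
... | yes _ = j
... | no  _ = 1

primeOr1-≥1 : ∀ j → 1 ≤ j → 1 ≤ primeOr1 j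
primeOr1-≥1 j 1≤j with prime? j
... | yes _ = 1≤j
... | no  _ = ≤-refl

∏-primes-∣ : ∀ {X} lo len → (∀ p → Prime p → lo < p → p ≤ lo + len → p ∣ X) → ∏ primeOr1 lo len ∣ X
∏-primes-∣ {X} lo zero h = 1∣ X
∏-primes-∣ {X} lo (suc len) h
  with ih ← ∏-primes-∣ {X} lo len (λ p pr lo<p p≤ → h p pr lo<p (≤-trans p≤ (+-monoʳ-≤ lo (n≤1+n len))))
  with prime? (suc (lo + len))
... | no _ = subst (_∣ X) (sym (*-identityʳ _)) ih
... | yes pr = subst (_∣ X) (trans (cong (_* ∏ primeOr1 lo len) (*-identityʳ p)) (*-comm p _))
    (prime-power-*-∣ pr p∤∏ 1 (subst (_∣ X) (sym (*-identityʳ p)) (h p pr (s≤s (m≤m+n lo len)) (≤-reflexive (sym (+-suc lo len))))) ih)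
  where
  p = suc (lo + len)
  -- A prime dividing the product divides one factor, and the earlier factors are 1 or lie between 1
  -- and `lo + len`, below `p`.
  p∤∏ : ¬ (p ∣ ∏ primeOr1 lo len)
  p∤∏ p∣∏ with prime-∣-∏ primeOr1 lo len pr p∣∏
  ... | j , lo<j , j≤ , p∣j with prime? j
  ...   | yes _ = contradiction (∣⇒≤ {{>-nonZero (≤-trans (s≤s z≤n) lo<j)}} p∣j) (<⇒≱ (s≤s j≤))
  ...   | no  _ = contradiction (subst Prime (∣1⇒≡1 p∣j) pr) ¬prime[1]

prime-∣-! : ∀ {p} → Prime p → ∀ m → p ∣ m ! → p ≤ m
prime-∣-! pr zero p∣1 = contradiction (subst Prime (∣1⇒≡1 p∣1) pr) ¬prime[1]
prime-∣-! pr (suc m) p∣ with euclidsLemma (suc m) (m !) pr p∣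
... | inj₁ p∣1+m = ∣⇒≤ p∣1+m
... | inj₂ p∣m!  = m≤n⇒m≤1+n (prime-∣-! pr m p∣m!)

-- The prime divides `(m + m) !`, which is the binomial coefficient times `m ! * m !`, but being
-- larger than `m` it does not divide `m !`.
prime-∣-centralBinomial : ∀ {p} m → Prime p → m < p → p ≤ m + m → p ∣ (m + m) C m
prime-∣-centralBinomial {p@(suc q)} m pr m<p p≤2m
  with euclidsLemma ((m + m) C m) (m ! * m !) pr (subst (p ∣_) (sym eq) p∣)
  where
  instance _ = m !* m !≢0
  p∣ : p ∣ (m + m) !
  p∣ = ∣-trans (m∣m*n (q !)) (m≤n⇒m!∣n! p≤2m)
  eq : ((m + m) C m) * (m ! * m !) ≡ (m + m) !
  eq = begin
    ((m + m) C m) * (m ! * m !)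
      ≡⟨ cong (_* (m ! * m !)) (trans (nCk≡n!/k![n-k]! (m≤m+n m m)) (/-congʳ (cong (λ ● → m ! * ● !) (m+n∸m≡n m m)))) ⟩
    ((m + m) ! / (m ! * m !)) * (m ! * m !)
      ≡⟨ m/n*n≡m (subst (λ ● → m ! * ● ! ∣ (m + m) !) (m+n∸m≡n m m) (k![n∸k]!∣n! (m≤m+n m m))) ⟩
    (m + m) ! ∎
    where
    open ≡-Reasoning
    instance _ = m !* ((m + m) ∸ m) !≢0
... | inj₁ p∣C = p∣C
... | inj₂ p∣!! with euclidsLemma (m !) (m !) pr p∣!!
...   | inj₁ p∣m! = contradiction (prime-∣-! pr m p∣m!) (<⇒≱ m<p)
...   | inj₂ p∣m! = contradiction (prime-∣-! pr m p∣m!) (<⇒≱ m<p)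

double : ∀ m → m + m ≡ 2 * m
double m = cong (λ ● → m + ●) (sym (+-identityʳ m))

-- Erdős's bound, by doubling: the primes in (m , 2 m] multiply to a divisor of the central binomial
-- coefficient, which is at most `2 ^ (2 * m)`. Only powers of two are needed as end points below.
primorial-≤ : ∀ j → ∏ primeOr1 0 (2 ^ j) ≤ 2 ^ (2 * 2 ^ j)
primorial-≤ zero = s≤s z≤n
primorial-≤ (suc j) = begin
  ∏ primeOr1 0 (2 * m)                ≡⟨ cong (∏ primeOr1 0) (double m) ⟨
  ∏ primeOr1 0 (m + m)                ≡⟨ ∏-split primeOr1 0 m m ⟩
  ∏ primeOr1 0 m * ∏ primeOr1 m m     ≤⟨ *-mono-≤ (primorial-≤ j) upper ⟩
  2 ^ (2 * m) * 2 ^ (2 * m)           ≡⟨ ^-distribˡ-+-* 2 (2 * m) (2 * m) ⟨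
  2 ^ (2 * m + 2 * m)                 ≡⟨ cong (2 ^_) (double (2 * m)) ⟩
  2 ^ (2 * (2 * m))                   ∎
  where
  open ≤-Reasoning
  m = 2 ^ j
  upper : ∏ primeOr1 m m ≤ 2 ^ (2 * m)
  upper = begin
    ∏ primeOr1 m m ≤⟨ ∣⇒≤ {{binomial-nonZero (m + m) m (m≤m+n m m)}}
                        (∏-primes-∣ m m λ p pr m<p p≤2m → prime-∣-centralBinomial m pr m<p p≤2m) ⟩
    (m + m) C m    ≤⟨ binomial≤2^n (m + m) (m≤m+n m m) ⟩
    2 ^ (m + m)    ≡⟨ cong (2 ^_) (double m) ⟩
    2 ^ (2 * m)    ∎

-- A prime between x and 16 x

square-bound : ∀ t → 8 * ((7 + t) * (7 + t)) ≤ 13 * 2 ^ (5 + t)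
square-bound zero = ≤-trans (m≤m+n 392 24) ≤-refl
square-bound (suc t) = begin
  8 * ((8 + t) * (8 + t))             ≤⟨ m≤m+n _ _ ⟩
  8 * ((8 + t) * (8 + t)) + 8 * (34 + 12 * t + t * t) ≡⟨ lemma t ⟩
  2 * (8 * ((7 + t) * (7 + t)))       ≤⟨ *-monoʳ-≤ 2 (square-bound t) ⟩
  2 * (13 * 2 ^ (5 + t))      ≡⟨ comm (2 ^ (5 + t)) ⟩
  13 * 2 ^ (6 + t)            ∎
  where
  open ≤-Reasoning
  lemma : ∀ t → 8 * ((8 + t) * (8 + t)) + 8 * (34 + 12 * t + t * t) ≡ 2 * (8 * ((7 + t) * (7 + t)))
  lemma = solve-∀
  comm : ∀ u → 2 * (13 * u) ≡ 13 * (2 * u)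
  comm = solve-∀

^-monoʳ-≤⁻¹ : ∀ {m n} → 2 ^ m ≤ 2 ^ n → m ≤ n
^-monoʳ-≤⁻¹ {m} {n} h with m ≤? n
... | yes m≤n = m≤n
... | no  m≰n = contradiction h (<⇒≱ (^-monoʳ-< 2 (s≤s (s≤s z≤n)) (≰⇒> m≰n)))

^-monoʳ-<⁻¹ : ∀ {m n} → 2 ^ m < 2 ^ n → m < n
^-monoʳ-<⁻¹ {m} {n} h with m <? n
... | yes m<n = m<n
... | no  m≮n = contradiction h (≤⇒≯ (^-monoʳ-≤ 2 (≮⇒≥ m≮n)))

-- With `s` the integer square root of `2 ^ E`, the product of these numbers over all j up to
-- `2 ^ E` is a common multiple of 1, ..., `2 ^ E`. It exceeds the least one only through the
-- generous exponent `E` at the primes up to `s`.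
smallPrimePower : (s E j : ℕ) → ℕ
smallPrimePower s E j with prime? j | j ≤? s
... | no  _ | _     = 1
... | yes _ | yes _ = j ^ E
... | yes _ | no  _ = j

module _ (s E : ℕ) where
  private G = smallPrimePower s E

  smallPrimePower-≥1 : ∀ j → 1 ≤ j → 1 ≤ G j
  smallPrimePower-≥1 j 1≤j with prime? j | j ≤? s
  ... | no  _ | _     = ≤-refl
  ... | yes _ | yes _ = m^n>0 j {{>-nonZero 1≤j}} E
  ... | yes _ | no  _ = 1≤j

  smallPrimePower-small : ∀ j → 1 ≤ j → j ≤ s → G j ≤ s ^ E
  smallPrimePower-small j 1≤j j≤s with prime? j | j ≤? s
  ... | no  _ | _     = m^n>0 s {{>-nonZero (≤-trans 1≤j j≤s)}} E
  ... | yes _ | yes _ = ^-monoˡ-≤ E j≤s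
  ... | yes _ | no j≰s = contradiction j≤s j≰s

  smallPrimePower-large : ∀ j → s < j → G j ≡ primeOr1 j
  smallPrimePower-large j s<j with prime? j | j ≤? s
  ... | no  _ | _     = refl
  ... | yes _ | yes j≤s = contradiction j≤s (<⇒≱ s<j)
  ... | yes _ | no  _ = refl

  -- For `p ≤ s`, already `2 ^ a ≤ p ^ a ≤ 2 ^ E` forces `a ≤ E`. For `p > s` the square of `p`
  -- exceeds `2 ^ E`, so `a` is 1.
  smallPrimePower-∣ : s * s ≤ 2 ^ E → 2 ^ E < suc s * suc s → ∀ p a → Prime p → 1 ≤ a → p ^ a ≤ 2 ^ E → p ^ a ∣ G p
  smallPrimePower-∣ lo hi p a pr 1≤a pᵃ≤ with prime? p | p ≤? s
  ... | no ¬pr | _ = contradiction pr ¬pr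
  ... | yes _ | yes _ = pᵃ∣pᴱ (^-monoʳ-≤⁻¹ (≤-trans (^-monoˡ-≤ a (prime≥2 pr)) pᵃ≤))
    where
    pᵃ∣pᴱ : a ≤ E → p ^ a ∣ p ^ E
    pᵃ∣pᴱ a≤E = subst (p ^ a ∣_) (trans (sym (^-distribˡ-+-* p a (E ∸ a))) (cong (p ^_) (m+[n∸m]≡n a≤E))) (m∣m*n _)
  smallPrimePower-∣ lo hi p (suc zero) pr 1≤a pᵃ≤ | yes _ | no _ = ∣-reflexive (*-identityʳ p)
  smallPrimePower-∣ lo hi p (suc (suc a)) pr 1≤a pᵃ≤ | yes _ | no p≰s =
    contradiction hi (≤⇒≯ (begin
      suc s * suc s   ≤⟨ *-mono-≤ (≰⇒> p≰s) (≰⇒> p≰s) ⟩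
      p * p           ≤⟨ *-monoʳ-≤ p (m≤m*n p (p ^ a)) ⟩
      p * (p * p ^ a) ≤⟨ pᵃ≤ ⟩
      2 ^ E           ∎))
    where
    open ≤-Reasoning
    instance
      _ = prime⇒nonZero pr
      pᵃ≢0 = m^n≢0 p a

module _ (t : ℕ) where
  private
    -- Here `s` is the square root of `n`, and `n` is `16 * x`. The range up to `n` is cut into (0 ,
    -- s], (s , x] and (x , n]; `d` and `e` are the lengths of the last two pieces.
    u v s x n E d e M : ℕ
    u = 7 + t
    v = 5 + t
    s = 2 ^ u
    x = 2 ^ (2 * v)
    E = 2 * u
    n = 2 ^ E
    d = x ∸ s
    e = n ∸ x
    M = ∏ (smallPrimePower s E) 0 n

    s²≡n : s * s ≡ n
    s²≡n = trans (sym (^-distribˡ-+-* 2 u u)) (cong (2 ^_) (double u))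

    s+d≡x : s + d ≡ x
    s+d≡x = m+[n∸m]≡n (^-monoʳ-≤ 2 (≤-trans (m≤m+n u (3 + t)) (≤-reflexive (lemma t))))
      where
      lemma : ∀ t → 7 + t + (3 + t) ≡ 2 * (5 + t)
      lemma = solve-∀

    x+e≡n : x + e ≡ n
    x+e≡n = m+[n∸m]≡n (^-monoʳ-≤ 2 (*-monoʳ-≤ 2 (m≤n+m v 2)))

    n≡16x : n ≡ 16 * x
    n≡16x = trans (cong (2 ^_) (lemma t)) (^-distribˡ-+-* 2 4 (2 * v))
      where
      lemma : ∀ t → 2 * (7 + t) ≡ 4 + 2 * (5 + t)
      lemma = solve-∀

    -- The multiples are those of 1, ..., n, and `commonMultiple-≥2^n` counts up to a successor,
    -- hence the exponent `pred n`.
    M≥ : 2 ^ pred n ≤ M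
    M≥ = commonMultiple-≥2^n (pred n) {{>-nonZero (∏-≥1 0 n (smallPrimePower-≥1 s E))}}
      λ j 1≤j j≤ → commonMultiple {n = n}
        (λ p a pr 1≤a pᵃ≤n → ∣-trans
          (smallPrimePower-∣ s E (≤-reflexive s²≡n) (<-≤-trans (≤-reflexive (cong suc (sym s²≡n))) (*-mono-< (n<1+n s) (n<1+n s))) p a pr 1≤a pᵃ≤n)
          (∏-∣ (smallPrimePower s E) 0 n (<⇒≤ (prime≥2 pr)) (≤-trans (≤-trans (≤-reflexive (sym (*-identityʳ p))) (^-monoʳ-≤ p {{prime⇒nonZero pr}} 1≤a)) pᵃ≤n)))
        j 1≤j (≤-trans j≤ (≤-reflexive (suc-pred n {{m^n≢0 2 E}})))

    -- The primes up to `s` contribute at most `(s ^ E) ^ s`, which is `2 ^ (u * E * s)`. Since `s`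
    -- is `4 * 2 ^ v` and `x` is `2 ^ v * 2 ^ v`, the claim reduces to `square-bound`, which at
    -- `t = 0` reads 392 ≤ 416.
    exponent : u * E * s ≤ 13 * x
    exponent = begin
      u * (2 * u) * 2 ^ (2 + v)        ≡⟨ lemma u (2 ^ v) ⟩
      8 * (u * u) * 2 ^ v              ≤⟨ *-monoˡ-≤ (2 ^ v) (square-bound t) ⟩
      13 * 2 ^ v * 2 ^ v               ≡⟨ *-assoc 13 (2 ^ v) (2 ^ v) ⟩
      13 * (2 ^ v * 2 ^ v)             ≡⟨ cong (13 *_) (^-distribˡ-+-* 2 v v) ⟨
      13 * 2 ^ (v + v)                 ≡⟨ cong (λ ● → 13 * 2 ^ ●) (double v) ⟩
      13 * x                           ∎
      where
      open ≤-Reasoning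
      lemma : ∀ u w → u * (2 * u) * (2 * (2 * w)) ≡ 8 * (u * u) * w
      lemma = solve-∀

    -- The three pieces contribute at most `2 ^ (13 * x)`, `2 ^ (2 * x)` and, in the absence of
    -- primes, 1.
    M≤ : (∀ p → Prime p → x < p → p ≤ n → ⊥) → M ≤ 2 ^ (15 * x)
    M≤ noPrime = begin
      ∏ G 0 n                                 ≡⟨ cong (∏ G 0) (trans (cong (_+ e) s+d≡x) x+e≡n) ⟨
      ∏ G 0 (s + d + e)                       ≡⟨ ∏-split G 0 (s + d) e ⟩
      ∏ G 0 (s + d) * ∏ G (s + d) e           ≡⟨ cong₂ _*_ (∏-split G 0 s d) (cong (λ ● → ∏ G ● e) s+d≡x) ⟩
      ∏ G 0 s * ∏ G s d * ∏ G x e             ≤⟨ *-mono-≤ (*-mono-≤ low middle) high ⟩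
      (s ^ E) ^ s * 2 ^ (2 * x) * 1           ≡⟨ *-identityʳ _ ⟩
      (s ^ E) ^ s * 2 ^ (2 * x)               ≡⟨ cong (_* 2 ^ (2 * x)) (trans (cong (_^ s) (^-*-assoc 2 u E)) (^-*-assoc 2 (u * E) s)) ⟩
      2 ^ (u * E * s) * 2 ^ (2 * x)           ≡⟨ ^-distribˡ-+-* 2 (u * E * s) (2 * x) ⟨
      2 ^ (u * E * s + 2 * x)                 ≤⟨ ^-monoʳ-≤ 2 (+-monoˡ-≤ (2 * x) exponent) ⟩
      2 ^ (13 * x + 2 * x)                    ≡⟨ cong (2 ^_) (*-distribʳ-+ x 13 2) ⟨
      2 ^ (15 * x)                            ∎
      where
      open ≤-Reasoning
      G = smallPrimePower s E
      low : ∏ G 0 s ≤ (s ^ E) ^ s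
      low = ≤-trans (∏-mono-≤ 0 s (smallPrimePower-small s E)) (≤-reflexive (∏-const (s ^ E) 0 s))
      middle : ∏ G s d ≤ 2 ^ (2 * x)
      middle = begin
        ∏ G s d                             ≤⟨ ∏-mono-≤ s d (λ j s<j _ → ≤-reflexive (smallPrimePower-large s E j s<j)) ⟩
        ∏ primeOr1 s d                      ≤⟨ m≤n*m _ (∏ primeOr1 0 s) {{>-nonZero (∏-≥1 0 s primeOr1-≥1)}} ⟩
        ∏ primeOr1 0 s * ∏ primeOr1 s d     ≡⟨ ∏-split primeOr1 0 s d ⟨
        ∏ primeOr1 0 (s + d)                ≡⟨ cong (∏ primeOr1 0) s+d≡x ⟩
        ∏ primeOr1 0 x                      ≤⟨ primorial-≤ (2 * v) ⟩
        2 ^ (2 * x)                         ∎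
      high : ∏ G x e ≤ 1
      high = ≤-trans (∏-mono-≤ x e λ j x<j j≤ → ≤-trans
                        (≤-reflexive (smallPrimePower-large s E j (≤-<-trans (≤-trans (m≤m+n s d) (≤-reflexive s+d≡x)) x<j)))
                        (notPrime j x<j (≤-trans j≤ (≤-reflexive x+e≡n))))
               (≤-reflexive (trans (∏-const 1 x e) (^-zeroˡ e)))
        where
        notPrime : ∀ j → x < j → j ≤ n → primeOr1 j ≤ 1
        notPrime j x<j j≤n with prime? j
        ... | yes pr = ⊥-elim (noPrime j pr x<j j≤n)
        ... | no  _  = ≤-refl

  -- Without primes in this interval, a common multiple of 1, …, 2^(2(7+t))
  -- would have only small prime factors and be smaller than 2^(2^(2(7+t)) − 1).
  prime-between : ∃[ p ] (Prime p × 2 ^ (2 * (5 + t)) < p × p ≤ 2 ^ (2 * (7 + t)))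
  prime-between with anyUpTo? (λ p → prime? p ×-dec (x <? p)) (suc n)
  ... | yes (p , p<1+n , pr , x<p) = p , pr , x<p , ≤-pred p<1+n
  ... | no none = contradiction x>1 (≤⇒≯ x≤1)
    where
    pred≤ : pred n ≤ 15 * x
    pred≤ = ^-monoʳ-≤⁻¹ (≤-trans M≥ (M≤ λ p pr x<p p≤n → none (p , s≤s p≤n , pr , x<p)))
    -- From `pred n ≤ 15 * x` and `n ≡ 16 * x`; this is absurd as `x` is a positive power of 4.
    x≤1 : x ≤ 1
    x≤1 = +-cancelʳ-≤ (15 * x) x 1 (≤-trans (≤-reflexive (sym n≡16x)) (≤-trans (≤-reflexive (sym (suc-pred n {{m^n≢0 2 E}}))) (s≤s pred≤)))
    x>1 : 1 < x
    x>1 = ^-monoʳ-< 2 (s≤s (s≤s z≤n)) {0} {2 * v} (s≤s z≤n)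

-- The coloring of the flags of an affine plane

enumerate : ∀ {n} (S : Subset n) → Σ[ e ∈ (Fin ∣ S ∣ → Fin n) ]
            ((∀ i → e i ∈ₛ S) × (∀ i j → e i ≡ e j → i ≡ j))
enumerate [] = (λ ()) , (λ ()) , λ ()
enumerate (outside ∷ S) with e , e∈ , inj ← enumerate S =
  (λ i → Fin.suc (e i)) , (λ i → there (e∈ i)) , λ i j eq → inj i j (Fin.suc-injective eq)
enumerate (inside ∷ S) with e , e∈ , inj ← enumerate S = e′ , e′∈ , inj′
  where
  e′ : Fin (suc ∣ S ∣) → Fin _
  e′ Fin.zero    = Fin.zero
  e′ (Fin.suc i) = Fin.suc (e i)
  e′∈ : ∀ i → e′ i ∈ₛ inside ∷ S
  e′∈ Fin.zero    = here
  e′∈ (Fin.suc i) = there (e∈ i)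
  inj′ : ∀ i j → e′ i ≡ e′ j → i ≡ j
  inj′ Fin.zero    Fin.zero    _  = refl
  inj′ (Fin.suc i) (Fin.suc j) eq = cong Fin.suc (inj i j (Fin.suc-injective eq))

injectiveOn⇒∣∣≤ : ∀ {n k} (S : Subset n) (f : Fin n → Fin k) →
                  (∀ u v → u ∈ₛ S → v ∈ₛ S → f u ≡ f v → u ≡ v) → ∣ S ∣ ≤ k
injectiveOn⇒∣∣≤ S f f-inj with e , e∈ , e-inj ← enumerate S =
  injective⇒≤ {f = λ i → f (e i)} λ {i} {j} eq → e-inj i j (f-inj (e i) (e j) (e∈ i) (e∈ j) eq)

pair-↭ : ∀ {a d p : Color} → a ∷ d ∷ [] ↭ p ∷ p ∷ [] → a ≡ p × d ≡ p
pair-↭ π with a≡p ∷ d≡p ∷ [] ← All-resp-↭ (↭-sym π) (refl ∷ refl ∷ []) = a≡p , d≡p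

ppq↭qpp : ∀ (p q : Color) → p ∷ p ∷ q ∷ [] ↭ q ∷ p ∷ p ∷ []
ppq↭qpp p q = ↭-trans (Perm.prep p (Perm.swap p q Perm.refl)) (Perm.swap p q Perm.refl)

-- The last `q` occurs somewhere in the left-hand list; moving it to the front and cancelling it
-- leaves a permutation of two copies of `p`.
triple-↭ : ∀ {a d e p q : Color} → a ∷ d ∷ e ∷ [] ↭ p ∷ p ∷ q ∷ [] →
           (a ≡ p × d ≡ p × e ≡ q) ⊎ (a ≡ p × e ≡ p × d ≡ q) ⊎ (d ≡ p × e ≡ p × a ≡ q)
triple-↭ {a} {d} {e} {p} {q} π with ∈-resp-↭ (↭-sym π) (there (there (here refl)))
... | here refl
  with d≡p , e≡p ← pair-↭ (drop-∷ (↭-trans π (ppq↭qpp p q))) = inj₂ (inj₂ (d≡p , e≡p , refl))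
... | there (here refl)
  with a≡p , e≡p ← pair-↭ (drop-∷ (↭-trans (Perm.swap q a Perm.refl) (↭-trans π (ppq↭qpp p q)))) =
  inj₂ (inj₁ (a≡p , e≡p , refl))
... | there (there (here refl))
  with a≡p , d≡p ← pair-↭ (drop-∷ (↭-trans (Perm.swap q a Perm.refl)
                            (↭-trans (Perm.prep a (Perm.swap q d Perm.refl)) (↭-trans π (ppq↭qpp p q))))) =
  inj₁ (a≡p , d≡p , refl)

module _ {n} (c : Coloring n) where

  -- All three patterns have the form ppq, with `p ≡ q` allowed for rrr. Fixing `v` as the common
  -- end of the two `p`-edges replaces permutations by equations between colors.
  NoCherry : Color → Color → Set
  NoCherry p q = ∀ u v w → u ≢ v → v ≢ w → u ≢ w → color c u v ≡ p → color c v w ≡ p → color c u w ≢ q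

  noCherry⇒no-ppq : ∀ {p q} → NoCherry p q → ∀ u v w → u ≢ v → v ≢ w → u ≢ w →
                    ¬ Triangle-has c u v w (p ∷ p ∷ q ∷ [])
  noCherry⇒no-ppq h u v w u≢v v≢w u≢w π with triple-↭ π
  ... | inj₁ (uv , vw , uw) = h u v w u≢v v≢w u≢w uv vw uw
  ... | inj₂ (inj₁ (uv , uw , vw)) =
    h v u w (≢-sym u≢v) u≢w v≢w (trans (color-sym c v u) uv) uw vw
  ... | inj₂ (inj₂ (vw , uw , uv)) =
    h u w v u≢w (≢-sym v≢w) u≢v uw (trans (color-sym c w v) vw) uv

  noCherry⇒Forb : NoCherry r r → NoCherry r b → NoCherry b y → Forb n rrr-rrb-bby c
  noCherry⇒Forb rr rb by u v w u≢v v≢w u≢w p (here refl) = noCherry⇒no-ppq rr u v w u≢v v≢w u≢w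
  noCherry⇒Forb rr rb by u v w u≢v v≢w u≢w p (there (here refl)) = noCherry⇒no-ppq rb u v w u≢v v≢w u≢w
  noCherry⇒Forb rr rb by u v w u≢v v≢w u≢w p (there (there (here refl))) = noCherry⇒no-ppq by u v w u≢v v≢w u≢w

-- A vertex is a point (X , Z) with a slope M, and `intercept x z m` tells apart the parallel lines
-- of slope `m`. The hypotheses isolate the geometry: distinct points on one vertical line have
-- distinct parallels through them, and two points with different `x` share at most one line.
module Flags {n q : ℕ} (X Z M : Fin n → Fin q)
  (XZM-injective : ∀ u v → X u ≡ X v → Z u ≡ Z v → M u ≡ M v → u ≡ v)
  (intercept : Fin q → Fin q → Fin q → Fin q)
  (intercept-injective : ∀ x m {z z′} → intercept x z m ≡ intercept x z′ m → z ≡ z′)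
  (two-points-one-line : ∀ {x x′ z z′ m m′} → intercept x z m ≡ intercept x′ z′ m →
                         intercept x z m′ ≡ intercept x′ z′ m′ → x ≢ x′ → m ≡ m′)
  where

  line : Fin n → Fin q → Fin q
  line u m = intercept (X u) (Z u) m

  SameGroup : Fin n → Fin n → Set
  SameGroup u v = X u ≡ X v × M u ≡ M v

  Arrow : Fin n → Fin n → Set
  Arrow u v = X u <ᶠ X v × M u ≢ M v × line u (M v) ≡ line v (M v)

  sameGroup? : ∀ u v → Dec (SameGroup u v)
  sameGroup? u v = (X u Fin.≟ X v) ×-dec (M u Fin.≟ M v)

  arrow? : ∀ u v → Dec (Arrow u v)
  arrow? u v = (X u Fin.<? X v) ×-dec (¬? (M u Fin.≟ M v) ×-dec (line u (M v) Fin.≟ line v (M v)))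

  edgeColor : Fin n → Fin n → Color
  edgeColor u v with sameGroup? u v | arrow? u v ⊎-dec arrow? v u
  ... | yes _ | _     = b
  ... | no  _ | yes _ = r
  ... | no  _ | no  _ = y

  b⇒sameGroup : ∀ u v → edgeColor u v ≡ b → SameGroup u v
  b⇒sameGroup u v eq with sameGroup? u v | arrow? u v ⊎-dec arrow? v u
  b⇒sameGroup u v eq | yes same | _     = same
  b⇒sameGroup u v () | no _     | yes _
  b⇒sameGroup u v () | no _     | no _

  r⇒arrow : ∀ u v → edgeColor u v ≡ r → Arrow u v ⊎ Arrow v u
  r⇒arrow u v eq with sameGroup? u v | arrow? u v ⊎-dec arrow? v u
  r⇒arrow u v () | yes _ | _
  r⇒arrow u v eq | no _  | yes arr = arr
  r⇒arrow u v () | no _  | no _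

  sameGroup⇒b : ∀ u v → SameGroup u v → edgeColor u v ≡ b
  sameGroup⇒b u v same with sameGroup? u v | arrow? u v ⊎-dec arrow? v u
  ... | yes _  | _ = refl
  ... | no ¬same | _ = contradiction same ¬same

  arrow⇒r : ∀ u v → Arrow u v ⊎ Arrow v u → edgeColor u v ≡ r
  arrow⇒r u v arr with sameGroup? u v | arrow? u v ⊎-dec arrow? v u
  arrow⇒r u v (inj₁ (x< , _)) | yes (x≡ , _) | _ = contradiction (cong toℕ x≡) (<⇒≢ x<)
  arrow⇒r u v (inj₂ (x< , _)) | yes (x≡ , _) | _ = contradiction (cong toℕ (sym x≡)) (<⇒≢ x<)
  ... | no _  | yes _   = refl
  ... | no _  | no ¬arr = contradiction arr ¬arr

  other⇒y : ∀ u v → ¬ SameGroup u v → ¬ (Arrow u v ⊎ Arrow v u) → edgeColor u v ≡ y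
  other⇒y u v ¬same ¬arr with sameGroup? u v | arrow? u v ⊎-dec arrow? v u
  ... | yes same | _     = contradiction same ¬same
  ... | no _  | yes arr = contradiction arr ¬arr
  ... | no _  | no _    = refl

  edgeColor-sym : ∀ u v → edgeColor u v ≡ edgeColor v u
  edgeColor-sym u v with edgeColor v u in eq
  ... | b with x≡ , m≡ ← b⇒sameGroup v u eq = sameGroup⇒b u v (sym x≡ , sym m≡)
  ... | r = arrow⇒r u v (Sum.swap (r⇒arrow v u eq))
  ... | y = other⇒y u v
    (λ (x≡ , m≡) → contradiction (trans (sym eq) (sameGroup⇒b v u (sym x≡ , sym m≡))) λ ())
    (λ arr → contradiction (trans (sym eq) (arrow⇒r v u (Sum.swap arr))) λ ())

  coloring : Coloring n
  coloring = record { color = edgeColor ; color-sym = edgeColor-sym }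

  -- The points of u and of v would both lie on the lines of v and of w.
  no-transitive-triangle : ∀ u v w → Arrow u v → Arrow v w → Arrow u w → ⊥
  no-transitive-triangle u v w (x< , _ , uv) (_ , m≢ , vw) (_ , _ , uw) =
    m≢ (two-points-one-line uv (trans uw (sym vw)) (λ eq → <⇒≢ x< (cong toℕ eq)))

  -- Arrows increase `X`, so the two cyclic orientations of a red triangle are impossible; the other
  -- six are transitive.
  rr-free : NoCherry coloring r r
  rr-free u v w _ _ _ uv vw uw with r⇒arrow u v uv | r⇒arrow v w vw | r⇒arrow u w uw
  ... | inj₁ p | inj₁ q | inj₁ s = no-transitive-triangle u v w p q s
  ... | inj₁ p | inj₁ q | inj₂ s = <-irrefl refl (<-trans (proj₁ p) (<-trans (proj₁ q) (proj₁ s)))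
  ... | inj₁ p | inj₂ q | inj₁ s = no-transitive-triangle u w v s q p
  ... | inj₁ p | inj₂ q | inj₂ s = no-transitive-triangle w u v s p q
  ... | inj₂ p | inj₁ q | inj₁ s = no-transitive-triangle v u w p s q
  ... | inj₂ p | inj₁ q | inj₂ s = no-transitive-triangle v w u q s p
  ... | inj₂ p | inj₂ q | inj₁ s = <-irrefl refl (<-trans (proj₁ p) (<-trans (proj₁ s) (proj₁ q)))
  ... | inj₂ p | inj₂ q | inj₂ s = no-transitive-triangle w v u q p s

  -- A group consists of parallel lines with marked points on one vertical
  -- line, so a vertex has at most one red neighbour in it.
  rb-free : NoCherry coloring r b
  rb-free u v w _ _ u≢w uv vw uw with b⇒sameGroup u w uw
  ... | x≡ , m≡ with r⇒arrow u v uv | r⇒arrow v w vw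
  ... | inj₁ p | inj₁ q = <⇒≢ (<-trans (proj₁ p) (proj₁ q)) (cong toℕ x≡)
  ... | inj₂ p | inj₂ q = <⇒≢ (<-trans (proj₁ q) (proj₁ p)) (cong toℕ (sym x≡))
  ... | inj₁ (_ , _ , p) | inj₂ (_ , _ , q) =
    u≢w (XZM-injective u w x≡ (intercept-injective (X w) (M v)
      (subst (λ x → intercept x (Z u) (M v) ≡ line w (M v)) x≡ (trans p (sym q)))) m≡)
  ... | inj₂ (_ , _ , p) | inj₁ (_ , _ , q) =
    u≢w (XZM-injective u w x≡ (intercept-injective (X w) (M w)
      (subst₂ (λ x m → intercept x (Z u) m ≡ line w (M w)) x≡ m≡
        (trans (sym p) (trans (cong (line v) m≡) q)))) m≡)

  -- Blue means lying in the same group, which is a transitive relation.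
  by-free : NoCherry coloring b y
  by-free u v w _ _ _ uv vw uw with b⇒sameGroup u v uv | b⇒sameGroup v w vw
  ... | x≡ , m≡ | x≡′ , m≡′ =
    contradiction (trans (sym uw) (sameGroup⇒b u w (trans x≡ x≡′ , trans m≡ m≡′))) λ ()

  coloring-Forb : Forb n rrr-rrb-bby coloring
  coloring-Forb = noCherry⇒Forb coloring rr-free rb-free by-free

  Avoids : Color → Subset n → Set
  Avoids a S = ∀ u v → u ∈ₛ S → v ∈ₛ S → u ≢ v → edgeColor u v ≢ a

  -- There are `q * q` groups, and each contains at most one flag of the set.
  no-b⇒∣∣≤ : ∀ S → Avoids b S → ∣ S ∣ ≤ q * q
  no-b⇒∣∣≤ S no-b = injectiveOn⇒∣∣≤ S (λ u → combine (X u) (M u)) inj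
    where
    inj : ∀ u v → u ∈ₛ S → v ∈ₛ S → combine (X u) (M u) ≡ combine (X v) (M v) → u ≡ v
    inj u v u∈ v∈ eq with u Fin.≟ v
    ... | yes u≡v = u≡v
    ... | no  u≢v = contradiction (sameGroup⇒b u v (combine-injective (X u) (M u) (X v) (M v) eq)) (no-b u v u∈ v∈ u≢v)

  -- S meets at most two groups: vertices of three groups span a red triangle.
  no-y⇒∣∣≤ : ∀ S → Avoids y S → ∣ S ∣ ≤ 2 * q
  no-y⇒∣∣≤ S no-y with nonempty? S
  ... | no empty = injectiveOn⇒∣∣≤ S (λ u → combine {2} {q} Fin.zero (Z u)) λ u _ u∈ → contradiction (u , u∈) empty
  ... | yes (o , o∈) = injectiveOn⇒∣∣≤ S (λ u → combine (side u) (Z u)) inj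
    where
    side : Fin n → Fin 2
    side u with sameGroup? u o
    ... | yes _ = Fin.zero
    ... | no  _ = Fin.suc Fin.zero
    red : ∀ u v → u ∈ₛ S → v ∈ₛ S → ¬ SameGroup u v → edgeColor u v ≡ r
    red u v u∈ v∈ ¬same with edgeColor u v in eq
    ... | r = refl
    ... | b = contradiction (b⇒sameGroup u v eq) ¬same
    ... | y = contradiction eq (no-y u v u∈ v∈ λ { refl → ¬same (refl , refl) })
    sides : ∀ u v → u ∈ₛ S → v ∈ₛ S → side u ≡ side v → SameGroup u v
    sides u v u∈ v∈ eq with sameGroup? u o | sameGroup? v o
    sides u v u∈ v∈ eq | yes (x≡ , m≡) | yes (x≡′ , m≡′) = trans x≡ (sym x≡′) , trans m≡ (sym m≡′)
    sides u v u∈ v∈ () | yes _ | no _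
    sides u v u∈ v∈ () | no _  | yes _
    sides u v u∈ v∈ eq | no u≁o | no v≁o with sameGroup? u v
    ... | yes same = same
    ... | no  u≁v  = contradiction (red u o u∈ o∈ u≁o)
      (rr-free u v o (λ { refl → u≁v (refl , refl) }) (λ { refl → v≁o (refl , refl) }) (λ { refl → u≁o (refl , refl) })
        (red u v u∈ v∈ u≁v) (red v o v∈ o∈ v≁o))
    inj : ∀ u v → u ∈ₛ S → v ∈ₛ S → combine (side u) (Z u) ≡ combine (side v) (Z v) → u ≡ v
    inj u v u∈ v∈ eq with side≡ , z≡ ← combine-injective (side u) (Z u) (side v) (Z v) eq
      with x≡ , m≡ ← sides u v u∈ v∈ side≡ = XZM-injective u v x≡ z≡ m≡

  -- A flag is charged to its line if it is the last one of S on this line,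
  -- and to its point otherwise.
  no-r⇒∣∣≤ : ∀ S → Avoids r S → ∣ S ∣ ≤ 2 * (q * q)
  no-r⇒∣∣≤ S no-r = injectiveOn⇒∣∣≤ S (λ u → combine (proj₁ (charge u)) (proj₂ (charge u)))
    λ u v u∈ v∈ eq → inj u v u∈ v∈ (Product.×-≡,≡→≡ (combine-injective (proj₁ (charge u)) _ (proj₁ (charge v)) _ eq))
    where
    Later : Fin n → Fin n → Set
    Later u v = v ∈ₛ S × X u <ᶠ X v × M u ≡ M v × line u (M u) ≡ line v (M v)
    later? : ∀ u → Dec (∃[ v ] Later u v)
    later? u = Fin.any? λ v → (v ∈? S) ×-dec ((X u Fin.<? X v) ×-dec ((M u Fin.≟ M v) ×-dec (line u (M u) Fin.≟ line v (M v))))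
    charge : Fin n → Fin 2 × Fin (q * q)
    charge u with later? u
    ... | no  _ = Fin.zero , combine (M u) (line u (M u))
    ... | yes _ = Fin.suc Fin.zero , combine (X u) (Z u)
    inj : ∀ u v → u ∈ₛ S → v ∈ₛ S → charge u ≡ charge v → u ≡ v
    inj u v u∈ v∈ eq with later? u | later? v
    inj u v u∈ v∈ () | yes _ | no _
    inj u v u∈ v∈ () | no _ | yes _
    inj u v u∈ v∈ eq | no ¬u | no ¬v
      with m≡ , l≡ ← combine-injective (M u) _ (M v) _ (cong proj₂ eq)
      with Fin.<-cmp (X u) (X v)
    ... | tri< x< _ _ = contradiction (v , v∈ , x< , m≡ , l≡) ¬u
    ... | tri> _ _ x> = contradiction (u , u∈ , x> , sym m≡ , sym l≡) ¬v
    ... | tri≈ _ x≡ _ = XZM-injective u v x≡ (intercept-injective (X v) (M v)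
          (subst₂ (λ x m → intercept x (Z u) m ≡ line v (M v)) x≡ m≡ l≡)) m≡
    inj u v u∈ v∈ eq | yes (w , w∈ , x< , m≡ , l≡) | yes _
      with x≡ , z≡ ← combine-injective (X u) (Z u) (X v) (Z v) (cong proj₂ eq)
      with M u Fin.≟ M v
    ... | yes mu≡mv = XZM-injective u v x≡ z≡ mu≡mv
    -- The flag `w` comes later on the line of `u`. That line passes through the point shared by `u`
    -- and `v`, so if `v` had another slope there would be an arrow from `v` to `w`.
    ... | no  mu≢mv = contradiction (arrow⇒r v w (inj₁ (subst (_<ᶠ X w) x≡ x< , (λ mv≡mw → mu≢mv (trans m≡ (sym mv≡mw))) , onLine)))
          (no-r v w v∈ w∈ λ { refl → <⇒≢ x< (cong toℕ x≡) })
      where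
      onLine : line v (M w) ≡ line w (M w)
      onLine = trans (cong₂ (λ x z → intercept x z (M w)) (sym x≡) (sym z≡)) (trans (cong (line u) (sym m≡)) l≡)

  twoColors-∣∣≤ : 1 ≤ q → ∀ S → UsesAtMostTwoColors coloring S → ∣ S ∣ ≤ 2 * (q * q)
  twoColors-∣∣≤ 1≤q S (x , z , h) = bound x z h
    where
    instance _ = >-nonZero 1≤q
    avoids : ∀ a {x z} → a ≢ x → a ≢ z → (∀ u v → u ∈ₛ S → v ∈ₛ S → u ≢ v → edgeColor u v ≡ x ⊎ edgeColor u v ≡ z) → Avoids a S
    avoids a a≢x a≢z h u v u∈ v∈ u≢v eq with h u v u∈ v∈ u≢v
    ... | inj₁ eq′ = a≢x (trans (sym eq) eq′)
    ... | inj₂ eq′ = a≢z (trans (sym eq) eq′)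
    no-b : Avoids b S → ∣ S ∣ ≤ 2 * (q * q)
    no-b av = ≤-trans (no-b⇒∣∣≤ S av) (m≤n*m (q * q) 2)
    no-y : Avoids y S → ∣ S ∣ ≤ 2 * (q * q)
    no-y av = ≤-trans (no-y⇒∣∣≤ S av) (*-monoʳ-≤ 2 (m≤m*n q q))
    no-r : Avoids r S → ∣ S ∣ ≤ 2 * (q * q)
    no-r = no-r⇒∣∣≤ S
    bound : ∀ x z → (∀ u v → u ∈ₛ S → v ∈ₛ S → u ≢ v → edgeColor u v ≡ x ⊎ edgeColor u v ≡ z) → ∣ S ∣ ≤ 2 * (q * q)
    bound r r h = no-b (avoids b (λ ()) (λ ()) h)
    bound r b h = no-y (avoids y (λ ()) (λ ()) h)
    bound r y h = no-b (avoids b (λ ()) (λ ()) h)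
    bound b r h = no-y (avoids y (λ ()) (λ ()) h)
    bound b b h = no-y (avoids y (λ ()) (λ ()) h)
    bound b y h = no-r (avoids r (λ ()) (λ ()) h)
    bound y r h = no-b (avoids b (λ ()) (λ ()) h)
    bound y b h = no-r (avoids r (λ ()) (λ ()) h)
    bound y y h = no-r (avoids r (λ ()) (λ ()) h)

-- The affine plane over the field with q elements

module PrimePlane (q : ℕ) (q-prime : Prime q) where
  private instance _ = prime⇒nonZero q-prime

  -- The lines are z + m x = const modulo `q`, so `m` is the slope up to sign.
  intercept : Fin q → Fin q → Fin q → Fin q
  intercept x z m = fromℕ< (m%n<n (toℕ z + toℕ m * toℕ x) q)

  %-≡⇒∣ : ∀ k l → k % q ≡ l % q → + q ∣ℤ + k ℤ.- + l
  %-≡⇒∣ k l eq = ℤ∣.divides (+ (k / q) ℤ.- + (l / q)) (begin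
    + k ℤ.- + l
      ≡⟨ cong₂ (λ s t → + s ℤ.- + t) (m≡m%n+[m/n]*n k q) (m≡m%n+[m/n]*n l q) ⟩
    + (k % q + k / q * q) ℤ.- + (l % q + l / q * q)
      ≡⟨ cong₂ ℤ._-_ (cast (k % q) (k / q)) (cast (l % q) (l / q)) ⟩
    (+ (k % q) ℤ.+ + (k / q) ℤ.* + q) ℤ.- (+ (l % q) ℤ.+ + (l / q) ℤ.* + q)
      ≡⟨ cong (λ ● → (+ ● ℤ.+ + (k / q) ℤ.* + q) ℤ.- (+ (l % q) ℤ.+ + (l / q) ℤ.* + q)) eq ⟩
    (+ (l % q) ℤ.+ + (k / q) ℤ.* + q) ℤ.- (+ (l % q) ℤ.+ + (l / q) ℤ.* + q)
      ≡⟨ lemma (+ (l % q)) (+ (k / q)) (+ (l / q)) (+ q) ⟩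
    (+ (k / q) ℤ.- + (l / q)) ℤ.* + q ∎)
    where
    open ≡-Reasoning
    cast : ∀ s t → + (s + t * q) ≡ + s ℤ.+ + t ℤ.* + q
    cast s t = trans (ℤ.pos-+ s (t * q)) (cong (ℤ._+_ (+ s)) (ℤ.pos-* t q))
    lemma : ∀ s t u v → (s ℤ.+ t ℤ.* v) ℤ.- (s ℤ.+ u ℤ.* v) ≡ (t ℤ.- u) ℤ.* v
    lemma = ℤ-Ring.solve-∀

  -- Two residues in [0 , q) differ by less than `q`.
  ∣⇒≡ : ∀ (i j : Fin q) → + q ∣ℤ + toℕ i ℤ.- + toℕ j → i ≡ j
  ∣⇒≡ i j d with ∣ toℕ i - toℕ j ∣ in eq
  ... | zero  = toℕ-injective (∣m-n∣≡0⇒m≡n eq)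
  ... | suc k = contradiction (∣⇒≤ (subst (q ∣_) abs≡ (ℤ∣.∣⇒∣ᵤ d))) (<⇒≱ (subst (_< q) eq small))
    where
    small : ∣ toℕ i - toℕ j ∣ < q
    small = ≤-<-trans (∣m-n∣≤m⊔n (toℕ i) (toℕ j)) (⊔-pres-<m (toℕ<n i) (toℕ<n j))
    abs≡ : ℤ.∣ + toℕ i ℤ.- + toℕ j ∣ ≡ suc k
    abs≡ = trans (cong ℤ.∣_∣ (ℤ.m-n≡m⊖n (toℕ i) (toℕ j))) (trans (abs-⊖ (toℕ i) (toℕ j)) eq)
      where
      abs-⊖ : ∀ m n → ℤ.∣ m ℤ.⊖ n ∣ ≡ ∣ m - n ∣
      abs-⊖ m n with ≤-total m n
      ... | inj₁ m≤n = trans (ℤ.∣⊖∣-≤ m≤n) (sym (m≤n⇒∣m-n∣≡n∸m m≤n))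
      ... | inj₂ n≤m = trans (ℤ.∣m⊖n∣≡∣n⊖m∣ m n) (trans (ℤ.∣⊖∣-≤ n≤m) (sym (m≤n⇒∣n-m∣≡n∸m n≤m)))

  intercept-∣ : ∀ x x′ z z′ m m′ → intercept x z m ≡ intercept x′ z′ m′ →
                + q ∣ℤ (+ toℕ z ℤ.+ + toℕ m ℤ.* + toℕ x) ℤ.- (+ toℕ z′ ℤ.+ + toℕ m′ ℤ.* + toℕ x′)
  intercept-∣ x x′ z z′ m m′ eq =
    subst₂ (λ s t → + q ∣ℤ s ℤ.- t) (cast z m x) (cast z′ m′ x′)
      (%-≡⇒∣ (toℕ z + toℕ m * toℕ x) (toℕ z′ + toℕ m′ * toℕ x′)
        (trans (sym (toℕ-fromℕ< _)) (trans (cong toℕ eq) (toℕ-fromℕ< _))))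
    where
    cast : ∀ (z m x : Fin q) → + (toℕ z + toℕ m * toℕ x) ≡ + toℕ z ℤ.+ + toℕ m ℤ.* + toℕ x
    cast z m x = trans (ℤ.pos-+ (toℕ z) (toℕ m * toℕ x)) (cong (ℤ._+_ (+ toℕ z)) (ℤ.pos-* (toℕ m) (toℕ x)))

  intercept-injective : ∀ x m {z z′} → intercept x z m ≡ intercept x z′ m → z ≡ z′
  intercept-injective x m {z} {z′} eq = ∣⇒≡ z z′
    (subst (+ q ∣ℤ_) (lemma (+ toℕ z) (+ toℕ z′) (+ toℕ m ℤ.* + toℕ x)) (intercept-∣ x x z z′ m m eq))
    where
    lemma : ∀ s t u → (s ℤ.+ u) ℤ.- (t ℤ.+ u) ≡ s ℤ.- t
    lemma = ℤ-Ring.solve-∀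

  -- Subtracting the two congruences eliminates `z` and `z′` and leaves (m - m′)(x - x′) ≡ 0 modulo
  -- the prime `q`.
  two-points-one-line : ∀ {x x′ z z′ m m′} → intercept x z m ≡ intercept x′ z′ m →
                        intercept x z m′ ≡ intercept x′ z′ m′ → x ≢ x′ → m ≡ m′
  two-points-one-line {x} {x′} {z} {z′} {m} {m′} eq eq′ x≢x′ =
    [ (λ q∣Δm → ∣⇒≡ m m′ (ℤ∣.∣ᵤ⇒∣ q∣Δm)) , (λ q∣Δx → contradiction (∣⇒≡ x x′ (ℤ∣.∣ᵤ⇒∣ q∣Δx)) x≢x′) ]′
    (euclidsLemma ℤ.∣ Δm ∣ ℤ.∣ Δx ∣ q-prime (subst (q ∣_) (ℤ.abs-* Δm Δx) (ℤ∣.∣⇒∣ᵤ q∣Δm*Δx)))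
    where
    Δm Δx : ℤ
    Δm = + toℕ m ℤ.- + toℕ m′
    Δx = + toℕ x ℤ.- + toℕ x′
    lemma : ∀ x x′ z z′ m m′ →
      ((z ℤ.+ m ℤ.* x) ℤ.- (z′ ℤ.+ m ℤ.* x′)) ℤ.- ((z ℤ.+ m′ ℤ.* x) ℤ.- (z′ ℤ.+ m′ ℤ.* x′))
      ≡ (m ℤ.- m′) ℤ.* (x ℤ.- x′)
    lemma = ℤ-Ring.solve-∀
    q∣Δm*Δx : + q ∣ℤ Δm ℤ.* Δx
    q∣Δm*Δx = subst (+ q ∣ℤ_) (lemma (+ toℕ x) (+ toℕ x′) (+ toℕ z) (+ toℕ z′) (+ toℕ m) (+ toℕ m′))
      (ℤ∣.∣m∣n⇒∣m-n (intercept-∣ x x′ z z′ m m eq) (intercept-∣ x x′ z z′ m′ m′ eq′))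

-- The vertices are the first `n` of all `q * (q * q)` flags, with base-`q` digits as coordinates.
prime⇒coloring : ∀ {q n} → Prime q → n ≤ q * (q * q) →
  Σ[ c ∈ Coloring n ] (Forb n rrr-rrb-bby c × (∀ S → UsesAtMostTwoColors c S → ∣ S ∣ ≤ 2 * (q * q)))
prime⇒coloring {q} {n} q-prime n≤q³ = coloring , coloring-Forb , twoColors-∣∣≤ (>-nonZero⁻¹ q)
  where
  instance _ = prime⇒nonZero q-prime
  open PrimePlane q q-prime
  cube : Fin n → Fin (q * (q * q))
  cube u = inject≤ u n≤q³
  X Z M : Fin n → Fin q
  X u = proj₁ (remQuot (q * q) (cube u))
  Z u = proj₁ (remQuot q (proj₂ (remQuot {q} (q * q) (cube u))))
  M u = proj₂ (remQuot {q} q (proj₂ (remQuot {q} (q * q) (cube u))))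
  cube≡ : ∀ u → combine (X u) (combine (Z u) (M u)) ≡ cube u
  cube≡ u = trans (cong (combine (X u)) (Fin.combine-remQuot {q} q (proj₂ (remQuot {q} (q * q) (cube u)))))
                  (Fin.combine-remQuot {q} (q * q) (cube u))
  XZM-injective : ∀ u v → X u ≡ X v → Z u ≡ Z v → M u ≡ M v → u ≡ v
  XZM-injective u v x≡ z≡ m≡ = Fin.inject≤-injective n≤q³ n≤q³ u v
    (trans (sym (cube≡ u)) (trans (cong₂ combine x≡ (cong₂ combine z≡ m≡)) (cube≡ v)))
  open Flags X Z M XZM-injective intercept intercept-injective
    (λ {x} {x′} {z} {z′} → two-points-one-line {x} {x′} {z} {z′})

-- Existence of h₂(n,ℋ)

maximum : ∀ {P : Pred ℕ 0ℓ} → Decidable P → ∀ {k} N → P k → (∀ j → P j → j ≤ N) → Σ[ m ∈ ℕ ] IsMaximum P m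
maximum P? {k} N Pk bound with P? N
... | yes PN = N , PN , bound
maximum P? {k} zero Pk bound | no ¬P0 with refl ← n≤0⇒n≡0 (bound k Pk) = contradiction Pk ¬P0
maximum P? {k} (suc N) Pk bound | no ¬PN = maximum P? N Pk λ j Pj →
  ≤-pred (≤∧≢⇒< (bound j Pj) λ { refl → ¬PN Pj })

minimum : ∀ {P : Pred ℕ 0ℓ} → Decidable P → ∀ {k} → P k → Σ[ m ∈ ℕ ] IsMinimum P m
minimum {P} P? {k} Pk = go k 0 (+-identityʳ k) λ _ _ → z≤n
  where
  go : ∀ d i → d + i ≡ k → (∀ j → P j → i ≤ j) → Σ[ m ∈ ℕ ] IsMinimum P m
  go d i d+i≡k bound with P? i
  ... | yes Pi = i , Pi , bound
  go zero i refl bound | no ¬Pi = contradiction Pk ¬Pi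
  go (suc d) i d+i≡k bound | no ¬Pi = go d (suc i) (trans (+-suc d i) d+i≡k) λ j Pj →
    ≤∧≢⇒< (bound j Pj) λ { refl → ¬Pi Pj }

_≟ᶜ_ : ∀ (p q : Color) → Dec (p ≡ q)
r ≟ᶜ r = yes refl
r ≟ᶜ b = no λ ()
r ≟ᶜ y = no λ ()
b ≟ᶜ r = no λ ()
b ≟ᶜ b = yes refl
b ≟ᶜ y = no λ ()
y ≟ᶜ r = no λ ()
y ≟ᶜ b = no λ ()
y ≟ᶜ y = yes refl

anyColor? : ∀ {P : Pred Color 0ℓ} → Decidable P → Dec (∃[ x ] P x)
anyColor? P? = map′
  (λ { (inj₁ p) → r , p ; (inj₂ (inj₁ p)) → b , p ; (inj₂ (inj₂ p)) → y , p })
  (λ { (r , p) → inj₁ p ; (b , p) → inj₂ (inj₁ p) ; (y , p) → inj₂ (inj₂ p) })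
  (P? r ⊎-dec (P? b ⊎-dec P? y))

toFin₃ : Color → Fin 3
toFin₃ r = Fin.zero
toFin₃ b = Fin.suc Fin.zero
toFin₃ y = Fin.suc (Fin.suc Fin.zero)

fromFin₃ : Fin 3 → Color
fromFin₃ Fin.zero                     = r
fromFin₃ (Fin.suc Fin.zero)           = b
fromFin₃ (Fin.suc (Fin.suc Fin.zero)) = y

fromFin₃-toFin₃ : ∀ p → fromFin₃ (toFin₃ p) ≡ p
fromFin₃-toFin₃ r = refl
fromFin₃-toFin₃ b = refl
fromFin₃-toFin₃ y = refl

module _ {n} (c : Coloring n) where

  Forb⇒noCherry : Forb n rrr-rrb-bby c → NoCherry c r r × NoCherry c r b × NoCherry c b y
  Forb⇒noCherry forb = cherry (here refl) , cherry (there (here refl)) , cherry (there (there (here refl)))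
    where
    cherry : ∀ {p q} → (p ∷ p ∷ q ∷ []) ∈ rrr-rrb-bby → NoCherry c p q
    cherry p∈ u v w u≢v v≢w u≢w refl vw refl = forb u v w u≢v v≢w u≢w _ p∈
      (Perm.prep _ (subst (λ ● → ● ∷ color c u w ∷ [] ↭ color c u v ∷ color c u w ∷ []) (sym vw) Perm.refl))

  noCherry? : ∀ p q → Dec (NoCherry c p q)
  noCherry? p q = all? λ u → all? λ v → all? λ w →
    ¬? (u Fin.≟ v) →-dec (¬? (v Fin.≟ w) →-dec (¬? (u Fin.≟ w) →-dec
      ((color c u v ≟ᶜ p) →-dec ((color c v w ≟ᶜ p) →-dec ¬? (color c u w ≟ᶜ q)))))

  Forb? : Dec (Forb n rrr-rrb-bby c)
  Forb? = map′ (λ (rr , rb , by) → noCherry⇒Forb c rr rb by) Forb⇒noCherry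
    (noCherry? r r ×-dec (noCherry? r b ×-dec noCherry? b y))

  TwoColoredSize : Pred ℕ 0ℓ
  TwoColoredSize k = Σ[ S ∈ Subset n ] (∣ S ∣ ≡ k × UsesAtMostTwoColors c S)

  twoColoredSize? : Decidable TwoColoredSize
  twoColoredSize? k = anySubset? λ S → (∣ S ∣ ≟ k) ×-dec (anyColor? λ x → anyColor? λ z → all? λ u → all? λ v →
    (u ∈? S) →-dec ((v ∈? S) →-dec (¬? (u Fin.≟ v) →-dec ((color c u v ≟ᶜ x) ⊎-dec (color c u v ≟ᶜ z)))))

  abstract
    h₂-exists : Σ[ k ∈ ℕ ] IsH₂Of c k
    h₂-exists = maximum twoColoredSize? n
      (⊥ₛ , ∣⊥∣≡0 n , r , r , λ u v u∈⊥ → contradiction u∈⊥ ∉⊥)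
      λ { j (S , refl , _) → ∣p∣≤n S }

IsMaximum-unique : ∀ {P k m} → IsMaximum P k → IsMaximum P m → k ≡ m
IsMaximum-unique (Pk , k-max) (Pm , m-max) = ≤-antisym (m-max _ Pk) (k-max _ Pm)

-- Decoding a coded coloring gives back its colors only pointwise, with another proof of symmetry.
-- Hence all notions are transported along pointwise equality.
module _ {n} {c d : Coloring n} (c≗d : ∀ u v → color c u v ≡ color d u v) where

  noCherry-resp : ∀ {p q} → NoCherry c p q → NoCherry d p q
  noCherry-resp h u v w u≢v v≢w u≢w uv vw uw =
    h u v w u≢v v≢w u≢w (trans (c≗d u v) uv) (trans (c≗d v w) vw) (trans (c≗d u w) uw)

  Forb-resp : Forb n rrr-rrb-bby c → Forb n rrr-rrb-bby d
  Forb-resp forb with rr , rb , by ← Forb⇒noCherry c forb =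
    noCherry⇒Forb d (noCherry-resp rr) (noCherry-resp rb) (noCherry-resp by)

  twoColoredSize-resp : ∀ {k} → TwoColoredSize c k → TwoColoredSize d k
  twoColoredSize-resp (S , ∣S∣≡k , x , z , h) = S , ∣S∣≡k , x , z , λ u v u∈ v∈ u≢v →
    subst (λ ● → ● ≡ x ⊎ ● ≡ z) (c≗d u v) (h u v u∈ v∈ u≢v)

IsH₂Of-resp : ∀ {n} {c d : Coloring n} → (∀ u v → color c u v ≡ color d u v) → ∀ {k} → IsH₂Of c k → IsH₂Of d k
IsH₂Of-resp {c = c} {d} c≗d (attained , max) =
  twoColoredSize-resp {c = c} {d} c≗d attained , λ j size → max j (twoColoredSize-resp {c = d} {c} (λ u v → sym (c≗d u v)) size)

module _ (n : ℕ) where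

  Attained : Pred ℕ 0ℓ
  Attained k = Σ[ c ∈ Coloring n ] (Forb n rrr-rrb-bby c × IsH₂Of c k)

  -- The minimum over all colorings is found by search, so color matrices are coded by a finite
  -- type.
  decode : Fin (3 ^ (n * n)) → Fin n → Fin n → Color
  decode i u v = fromFin₃ (finToFun i (combine u v))

  encode : (Fin n → Fin n → Color) → Fin (3 ^ (n * n))
  encode f = funToFin {n * n} {3} λ k → toFin₃ (f (proj₁ (remQuot n k)) (proj₂ (remQuot {n} n k)))

  decode-encode : ∀ f u v → decode (encode f) u v ≡ f u v
  decode-encode f u v = begin
    fromFin₃ (finToFun (encode f) (combine u v))                     ≡⟨ cong fromFin₃ (finToFun-funToFin {n * n} {3} _ (combine u v)) ⟩
    fromFin₃ (toFin₃ (f (proj₁ (remQuot n (combine u v))) (proj₂ (remQuot {n} n (combine u v))))) ≡⟨ fromFin₃-toFin₃ _ ⟩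
    f (proj₁ (remQuot n (combine u v))) (proj₂ (remQuot {n} n (combine u v))) ≡⟨ cong (λ (s , t) → f s t) (remQuot-combine u v) ⟩
    f u v ∎
    where open ≡-Reasoning

  decoded : ∀ i → (∀ u v → decode i u v ≡ decode i v u) → Coloring n
  decoded i decode-sym = record { color = decode i ; color-sym = decode-sym }

  AttainedByCode : ℕ → Fin (3 ^ (n * n)) → Set
  AttainedByCode k i = Σ[ decode-sym ∈ (∀ u v → decode i u v ≡ decode i v u) ]
    (Forb n rrr-rrb-bby (decoded i decode-sym) × proj₁ (h₂-exists (decoded i decode-sym)) ≡ k)

  attainedByCode? : ∀ k i → Dec (AttainedByCode k i)
  attainedByCode? k i with all? (λ u → all? λ v → decode i u v ≟ᶜ decode i v u)
  ... | no ¬sym = no λ (decode-sym , _) → ¬sym decode-sym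
  ... | yes decode-sym = map′ (decode-sym ,_) irrelevant (Forb? c ×-dec (proj₁ (h₂-exists c) ≟ k))
    where
    c = decoded i decode-sym
    -- The given symmetry proof may differ from `decode-sym`, but the colors, and with them h₂, are
    -- the same.
    irrelevant : AttainedByCode k i → Forb n rrr-rrb-bby c × proj₁ (h₂-exists c) ≡ k
    irrelevant (decode-sym′ , forb , eq) =
      Forb-resp {c = d} {c} (λ _ _ → refl) forb ,
      trans (IsMaximum-unique (proj₂ (h₂-exists c)) (IsH₂Of-resp {c = d} {c} (λ _ _ → refl) (proj₂ (h₂-exists d)))) eq
      where d = decoded i decode-sym′

  attained? : Decidable Attained
  attained? k = map′ byColoring byCode (any? (attainedByCode? k))
    where
    byColoring : ∃[ i ] AttainedByCode k i → Attained k
    byColoring (i , decode-sym , forb , eq) =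
      decoded i decode-sym , forb , subst (IsH₂Of (decoded i decode-sym)) eq (proj₂ (h₂-exists (decoded i decode-sym)))
    byCode : Attained k → ∃[ i ] AttainedByCode k i
    byCode (c , forb , isH₂) = encode (color c) , color-sym d , Forb-resp {c = c} {d} c≗d forb ,
      IsMaximum-unique (proj₂ (h₂-exists d)) (IsH₂Of-resp {c = c} {d} c≗d isH₂)
      where
      c≗d : ∀ u v → color c u v ≡ decode (encode (color c)) u v
      c≗d u v = sym (decode-encode (color c) u v)
      d = decoded (encode (color c)) λ u v → trans (sym (c≗d u v)) (trans (color-sym c u v) (c≗d v u))

  allYellow : Coloring n
  allYellow = record { color = λ _ _ → y ; color-sym = λ _ _ → refl }

  abstract
    h₂-minimum : Σ[ m ∈ ℕ ] IsH₂ n rrr-rrb-bby m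
    h₂-minimum = minimum attained? (allYellow ,
      noCherry⇒Forb allYellow (λ _ _ _ _ _ _ ()) (λ _ _ _ _ _ _ ()) (λ _ _ _ _ _ _ ()) ,
      proj₂ (h₂-exists allYellow))

-- Independent sets in triangle-free graphs

filter-split-↭ : ∀ {A : Set} {P : Pred A 0ℓ} (P? : Decidable P) xs →
                 xs ↭ filter (λ x → ¬? (P? x)) xs ++ filter P? xs
filter-split-↭ P? [] = Perm.refl
filter-split-↭ P? (x ∷ xs) with P? x
... | yes _ = ↭-trans (prep x (filter-split-↭ P? xs)) (↭-sym (shift x _ _))
... | no  _ = prep x (filter-split-↭ P? xs)

-- Sums over lists and over their subsets

module _ {V : Set} where

  weight : (V → ℕ) → List V → ℕ
  weight f []       = 0
  weight f (x ∷ xs) = f x + weight f xs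

  weight-cong : ∀ {f g} → (∀ x → f x ≡ g x) → ∀ xs → weight f xs ≡ weight g xs
  weight-cong f≗g []       = refl
  weight-cong f≗g (x ∷ xs) = cong₂ _+_ (f≗g x) (weight-cong f≗g xs)

  weight-mono-≤ : ∀ {f g} → (∀ x → f x ≤ g x) → ∀ xs → weight f xs ≤ weight g xs
  weight-mono-≤ f≤g []       = z≤n
  weight-mono-≤ f≤g (x ∷ xs) = +-mono-≤ (f≤g x) (weight-mono-≤ f≤g xs)

  weight-↭ : ∀ f {xs ys} → xs ↭ ys → weight f xs ≡ weight f ys
  weight-↭ f Perm.refl = refl
  weight-↭ f (prep x π) = cong (λ ● → f x + ●) (weight-↭ f π)
  weight-↭ f (swap x z π) = trans (cong (λ ● → f x + (f z + ●)) (weight-↭ f π)) (lemma (f x) (f z) _)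
    where
    lemma : ∀ s t u → s + (t + u) ≡ t + (s + u)
    lemma = solve-∀
  weight-↭ f (Perm.trans π ρ) = trans (weight-↭ f π) (weight-↭ f ρ)

  weight-const : ∀ c xs → weight (λ _ → c) xs ≡ length xs * c
  weight-const c []       = refl
  weight-const c (x ∷ xs) = cong (λ ● → c + ●) (weight-const c xs)

  weight-+ : ∀ f g xs → weight (λ x → f x + g x) xs ≡ weight f xs + weight g xs
  weight-+ f g []       = refl
  weight-+ f g (x ∷ xs) = trans (cong (λ ● → f x + g x + ●) (weight-+ f g xs)) (lemma (f x) (g x) _ _)
    where
    lemma : ∀ s t u v → s + t + (u + v) ≡ s + u + (t + v)
    lemma = solve-∀

  weight-* : ∀ c f xs → weight (λ x → c * f x) xs ≡ c * weight f xs
  weight-* c f []       = sym (*-zeroʳ c)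
  weight-* c f (x ∷ xs) = trans (cong (λ ● → c * f x + ●) (weight-* c f xs)) (sym (*-distribˡ-+ c (f x) _))

  weight-swap : ∀ (f : V → V → ℕ) xs ys →
                weight (λ x → weight (f x) ys) xs ≡ weight (λ z → weight (λ x → f x z) xs) ys
  weight-swap f xs [] = trans (weight-const 0 xs) (*-zeroʳ (length xs))
  weight-swap f xs (z ∷ ys) = trans (weight-+ (λ x → f x z) (λ x → weight (f x) ys) xs)
    (cong (λ ● → weight (λ x → f x z) xs + ●) (weight-swap f xs ys))

  -- The accumulator `W` holds the choices made so far. Such sums stand in for expectations: divided
  -- by the sum of `independent`, a sum weighted by `independent` is an average over a uniformly
  -- random independent set.
  subsetSum : List V → (List V → ℕ) → List V → ℕ
  subsetSum []       F W = F W
  subsetSum (x ∷ xs) F W = subsetSum xs F (x ∷ W) + subsetSum xs F W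

  -- `Inv` relates the elements still to be decided to the accumulator. It survives both choices, so
  -- `F` and `G` are compared only at sets that really occur.
  subsetSum-mono-≤ : ∀ {F G : List V → ℕ} (Inv : List V → List V → Set) →
    (∀ {x xs W} → Inv (x ∷ xs) W → Inv xs (x ∷ W) × Inv xs W) →
    (∀ {W} → Inv [] W → F W ≤ G W) →
    ∀ xs {W} → Inv xs W → subsetSum xs F W ≤ subsetSum xs G W
  subsetSum-mono-≤ Inv step base [] inv = base inv
  subsetSum-mono-≤ Inv step base (x ∷ xs) inv with inv₁ , inv₀ ← step inv =
    +-mono-≤ (subsetSum-mono-≤ Inv step base xs inv₁) (subsetSum-mono-≤ Inv step base xs inv₀)

  subsetSum-cong : ∀ {F G} → (∀ W → F W ≡ G W) → ∀ xs W → subsetSum xs F W ≡ subsetSum xs G W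
  subsetSum-cong F≗G [] W = F≗G W
  subsetSum-cong F≗G (x ∷ xs) W = cong₂ _+_ (subsetSum-cong F≗G xs (x ∷ W)) (subsetSum-cong F≗G xs W)

  subsetSum-++ : ∀ xs ys F W → subsetSum (xs ++ ys) F W ≡ subsetSum xs (subsetSum ys F) W
  subsetSum-++ [] ys F W = refl
  subsetSum-++ (x ∷ xs) ys F W = cong₂ _+_ (subsetSum-++ xs ys F (x ∷ W)) (subsetSum-++ xs ys F W)

  subsetSum-≥ : ∀ xs F W → F W ≤ subsetSum xs F W
  subsetSum-≥ [] F W = ≤-refl
  subsetSum-≥ (x ∷ xs) F W = ≤-trans (subsetSum-≥ xs F W) (m≤n+m _ _)

  subsetSum-* : ∀ c xs F W → subsetSum xs (λ W → c * F W) W ≡ c * subsetSum xs F W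
  subsetSum-* c [] F W = refl
  subsetSum-* c (x ∷ xs) F W = trans
    (cong₂ _+_ (subsetSum-* c xs F (x ∷ W)) (subsetSum-* c xs F W))
    (sym (*-distribˡ-+ c (subsetSum xs F (x ∷ W)) _))

  subsetSum-weight : ∀ (F : V → List V → ℕ) vs xs W →
    weight (λ v → subsetSum xs (F v) W) vs ≡ subsetSum xs (λ W → weight (λ v → F v W) vs) W
  subsetSum-weight F vs [] W = refl
  subsetSum-weight F vs (x ∷ xs) W = trans
    (weight-+ (λ v → subsetSum xs (F v) (x ∷ W)) (λ v → subsetSum xs (F v) W) vs)
    (cong₂ _+_ (subsetSum-weight F vs xs (x ∷ W)) (subsetSum-weight F vs xs W))

  module _ {F : List V → ℕ} (F-resp : ∀ {W W′} → W ↭ W′ → F W ≡ F W′) where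

    subsetSum-resp : ∀ xs {W W′} → W ↭ W′ → subsetSum xs F W ≡ subsetSum xs F W′
    subsetSum-resp [] π = F-resp π
    subsetSum-resp (x ∷ xs) π = cong₂ _+_ (subsetSum-resp xs (prep x π)) (subsetSum-resp xs π)

    -- This lets a vertex and its neighbours be decided last. Reordering the decisions permutes the
    -- accumulator, hence the condition `F-resp`.
    subsetSum-↭ : ∀ {xs ys} → xs ↭ ys → ∀ W → subsetSum xs F W ≡ subsetSum ys F W
    subsetSum-↭ Perm.refl W = refl
    subsetSum-↭ (prep x π) W = cong₂ _+_ (subsetSum-↭ π (x ∷ W)) (subsetSum-↭ π W)
    subsetSum-↭ {_ ∷ _ ∷ xs} {_ ∷ _ ∷ ys} (swap x z π) W = begin
      subsetSum xs F (z ∷ x ∷ W) + subsetSum xs F (x ∷ W) + (subsetSum xs F (z ∷ W) + subsetSum xs F W)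
        ≡⟨ cong₂ _+_ (cong₂ _+_ (trans (subsetSum-↭ π _) (subsetSum-resp ys (swap z x Perm.refl))) (subsetSum-↭ π _))
                     (cong₂ _+_ (subsetSum-↭ π _) (subsetSum-↭ π _)) ⟩
      subsetSum ys F (x ∷ z ∷ W) + subsetSum ys F (x ∷ W) + (subsetSum ys F (z ∷ W) + subsetSum ys F W)
        ≡⟨ lemma (subsetSum ys F (x ∷ z ∷ W)) (subsetSum ys F (x ∷ W)) (subsetSum ys F (z ∷ W)) (subsetSum ys F W) ⟩
      subsetSum ys F (x ∷ z ∷ W) + subsetSum ys F (z ∷ W) + (subsetSum ys F (x ∷ W) + subsetSum ys F W) ∎
      where
      open ≡-Reasoning
      lemma : ∀ s t u v → s + t + (u + v) ≡ s + u + (t + v)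
      lemma = solve-∀
    subsetSum-↭ (Perm.trans π ρ) W = trans (subsetSum-↭ π W) (subsetSum-↭ ρ W)

n≤2^n : ∀ n → n ≤ 2 ^ n
n≤2^n zero = z≤n
n≤2^n (suc n) = +-mono-≤ (m^n>0 2 n) (≤-trans (n≤2^n n) (m≤m+n _ 0))

n≤4^n : ∀ n → n ≤ 4 ^ n
n≤4^n n = ≤-trans (n≤2^n n) (^-monoˡ-≤ n (s≤s (s≤s z≤n)))

-- Either `l ≤ x` and the last term dominates, or `x < l` and
-- `l * 2 ^ x ≤ 2 ^ l * 2 ^ l = 4 ^ l ≤ d`. In `fibre` the term `2 * d` is paid by the set
-- containing `v`, and `x * 2 ^ x` by the subsets of its `x` available neighbours.
fibre-bound : ∀ {d} l x → 4 ^ l ≤ d → l + l * 2 ^ x ≤ 2 * d + x * 2 ^ x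
fibre-bound {d} l x 4ˡ≤d with l ≤? x
... | yes l≤x = +-mono-≤ (≤-trans (≤-trans (n≤4^n l) 4ˡ≤d) (m≤m+n d _)) (*-monoˡ-≤ (2 ^ x) l≤x)
... | no  l≰x = begin
  l + l * 2 ^ x         ≤⟨ +-mono-≤ (≤-trans (n≤4^n l) 4ˡ≤d) l2ˣ≤d ⟩
  d + d                 ≡⟨ cong (λ ● → d + ●) (+-identityʳ d) ⟨
  2 * d                 ≤⟨ m≤m+n _ _ ⟩
  2 * d + x * 2 ^ x     ∎
  where
  open ≤-Reasoning
  l2ˣ≤d : l * 2 ^ x ≤ d
  l2ˣ≤d = begin
    l * 2 ^ x       ≤⟨ *-mono-≤ (n≤2^n l) (^-monoʳ-≤ 2 (<⇒≤ (≰⇒> l≰x))) ⟩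
    2 ^ l * 2 ^ l   ≡⟨ ^-distribˡ-+-* 2 l l ⟨
    2 ^ (l + l)     ≡⟨ cong (λ ● → 2 ^ (l + ●)) (+-identityʳ l) ⟨
    2 ^ (2 * l)     ≡⟨ ^-*-assoc 2 2 l ⟨
    4 ^ l           ≤⟨ 4ˡ≤d ⟩
    d               ∎

-- Resampling a random independent set on a closed neighbourhood

module TriangleFree {n : ℕ} {Adj : Fin n → Fin n → Set} (adj? : ∀ u v → Dec (Adj u v))
  (Adj-sym : ∀ {u v} → Adj u v → Adj v u)
  (Adj-irrefl : ∀ {u} → ¬ Adj u u)
  (triangle-free : ∀ {u v w} → Adj v u → Adj v w → ¬ Adj u w)
  where

  adjacent nonadjacent : Fin n → Fin n → ℕ
  adjacent u v with adj? u v
  ... | yes _ = 1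
  ... | no  _ = 0
  nonadjacent u v with adj? u v
  ... | yes _ = 0
  ... | no  _ = 1

  adjacent-sym : ∀ u v → adjacent u v ≡ adjacent v u
  adjacent-sym u v with adj? u v | adj? v u
  ... | yes _ | yes _ = refl
  ... | yes a | no ¬a = contradiction (Adj-sym a) ¬a
  ... | no ¬a | yes a = contradiction (Adj-sym a) ¬a
  ... | no  _ | no  _ = refl

  nonadjacent-sym : ∀ u v → nonadjacent u v ≡ nonadjacent v u
  nonadjacent-sym u v with adj? u v | adj? v u
  ... | yes _ | yes _ = refl
  ... | yes a | no ¬a = contradiction (Adj-sym a) ¬a
  ... | no ¬a | yes a = contradiction (Adj-sym a) ¬a
  ... | no  _ | no  _ = refl

  Adj⇒nonadjacent≡0 : ∀ {u v} → Adj u v → nonadjacent u v ≡ 0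
  Adj⇒nonadjacent≡0 {u} {v} a with adj? u v
  ... | yes _ = refl
  ... | no ¬a = contradiction a ¬a

  Adj⇒adjacent≡1 : ∀ {u v} → Adj u v → adjacent u v ≡ 1
  Adj⇒adjacent≡1 {u} {v} a with adj? u v
  ... | yes _ = refl
  ... | no ¬a = contradiction a ¬a

  ¬Adj⇒nonadjacent≡1 : ∀ {u v} → ¬ Adj u v → nonadjacent u v ≡ 1
  ¬Adj⇒nonadjacent≡1 {u} {v} ¬a with adj? u v
  ... | yes a = contradiction a ¬a
  ... | no  _ = refl

  weight-adjacent : ∀ v xs → weight (adjacent v) xs ≡ length (filter (adj? v) xs)
  weight-adjacent v [] = refl
  weight-adjacent v (x ∷ xs) with adj? v x
  ... | yes _ = cong suc (weight-adjacent v xs)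
  ... | no  _ = weight-adjacent v xs

  -- Both functions are 0/1-valued, so that a sum over all subsets counts the independent ones.
  free : Fin n → List (Fin n) → ℕ
  free v []      = 1
  free v (w ∷ W) = nonadjacent v w * free v W

  independent : List (Fin n) → ℕ
  independent []      = 1
  independent (w ∷ W) = free w W * independent W

  free-0∨1 : ∀ v W → free v W ≡ 0 ⊎ free v W ≡ 1
  free-0∨1 v [] = inj₂ refl
  free-0∨1 v (w ∷ W) with adj? v w
  ... | yes _ = inj₁ refl
  ... | no  _ = [ (λ eq → inj₁ (trans (+-identityʳ _) eq)) , (λ eq → inj₂ (trans (+-identityʳ _) eq)) ]′ (free-0∨1 v W)

  free-↭ : ∀ v {W W′} → W ↭ W′ → free v W ≡ free v W′
  free-↭ v Perm.refl = refl
  free-↭ v (prep x π) = cong (nonadjacent v x *_) (free-↭ v π)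
  free-↭ v (swap x z π) = trans (cong (λ ● → nonadjacent v x * (nonadjacent v z * ●)) (free-↭ v π))
    (lemma (nonadjacent v x) (nonadjacent v z) _)
    where
    lemma : ∀ s t u → s * (t * u) ≡ t * (s * u)
    lemma = solve-∀
  free-↭ v (Perm.trans π ρ) = trans (free-↭ v π) (free-↭ v ρ)

  independent-↭ : ∀ {W W′} → W ↭ W′ → independent W ≡ independent W′
  independent-↭ Perm.refl = refl
  independent-↭ (prep x π) = cong₂ _*_ (free-↭ x π) (independent-↭ π)
  independent-↭ {_ ∷ _ ∷ W} {_ ∷ _ ∷ W′} (swap x z π) = begin
    nonadjacent x z * free x W * (free z W * independent W)
      ≡⟨ cong₂ _*_ (cong₂ _*_ (nonadjacent-sym x z) (free-↭ x π)) (cong₂ _*_ (free-↭ z π) (independent-↭ π)) ⟩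
    nonadjacent z x * free x W′ * (free z W′ * independent W′)
      ≡⟨ lemma (nonadjacent z x) (free x W′) (free z W′) (independent W′) ⟩
    nonadjacent z x * free z W′ * (free x W′ * independent W′) ∎
    where
    open ≡-Reasoning
    lemma : ∀ s t u v → s * t * (u * v) ≡ s * u * (t * v)
    lemma = solve-∀
  independent-↭ (Perm.trans π ρ) = trans (independent-↭ π) (independent-↭ ρ)

  independent≤1 : ∀ W → independent W ≤ 1
  independent≤1 [] = ≤-refl
  independent≤1 (w ∷ W) with free-0∨1 w W
  ... | inj₁ eq rewrite eq = z≤n
  ... | inj₂ eq rewrite eq = ≤-trans (≤-reflexive (+-identityʳ _)) (independent≤1 W)

  free-Adj : ∀ {v w W} → w ∈ W → Adj v w → free v W ≡ 0
  free-Adj {v} {w} {_ ∷ W} (here refl) a = cong (_* free v W) (Adj⇒nonadjacent≡0 a)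
  free-Adj {v} {w} {z ∷ W} (there w∈) a = trans (cong (nonadjacent v z *_) (free-Adj w∈ a)) (*-zeroʳ (nonadjacent v z))

  independent⇒¬Adj : ∀ {W u v} → independent W ≢ 0 → u ∈ W → v ∈ W → ¬ Adj u v
  independent⇒¬Adj {w ∷ W} ind≢0 (here refl) (here refl) a = Adj-irrefl a
  independent⇒¬Adj {w ∷ W} ind≢0 (here refl) (there v∈) a = ind≢0 (cong (_* independent W) (free-Adj v∈ a))
  independent⇒¬Adj {w ∷ W} ind≢0 (there u∈) (here refl) a = ind≢0 (cong (_* independent W) (free-Adj u∈ (Adj-sym a)))
  independent⇒¬Adj {w ∷ W} ind≢0 (there u∈) (there v∈) a =
    independent⇒¬Adj (λ eq → ind≢0 (trans (cong (free w W *_) eq) (*-zeroʳ (free w W)))) u∈ v∈ a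

  Nonadjacent : Fin n → Fin n → Set
  Nonadjacent u v = nonadjacent u v ≡ 1

  available : List (Fin n) → List (Fin n) → ℕ
  available us W = weight (λ u → free u W) us

  available-∷ : ∀ {u us} W → All (Nonadjacent u) us → available us (u ∷ W) ≡ available us W
  available-∷ W [] = refl
  available-∷ {u} {z ∷ us} W (uz ∷ uzs) = cong₂ _+_
    (trans (cong (_* free z W) (trans (nonadjacent-sym z u) uz)) (*-identityˡ (free z W)))
    (available-∷ W uzs)

  -- No two vertices of `us` exclude each other, so each one without a neighbour in `W` is chosen
  -- freely and doubles the count.
  subsetSum-independent : ∀ {us} → AllPairs Nonadjacent us → ∀ W →
    subsetSum us independent W ≡ independent W * 2 ^ available us W
  subsetSum-independent [] W = sym (*-identityʳ _)
  subsetSum-independent {u ∷ us} (uz ∷ pairs) W = begin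
    subsetSum us independent (u ∷ W) + subsetSum us independent W
      ≡⟨ cong₂ _+_ (trans (subsetSum-independent pairs (u ∷ W)) (cong (λ ● → independent (u ∷ W) * 2 ^ ●) (available-∷ W uz)))
                   (subsetSum-independent pairs W) ⟩
    free u W * i * 2 ^ A + i * 2 ^ A
      ≡⟨ choose (free-0∨1 u W) ⟩
    i * 2 ^ (free u W + A) ∎
    where
    open ≡-Reasoning
    i = independent W
    A = available us W
    lemma : ∀ i e → 1 * i * e + i * e ≡ i * (2 * e)
    lemma = solve-∀
    choose : ∀ {f} → f ≡ 0 ⊎ f ≡ 1 → f * i * 2 ^ A + i * 2 ^ A ≡ i * 2 ^ (f + A)
    choose (inj₁ refl) = refl
    choose (inj₂ refl) = lemma i (2 ^ A)

  -- The subsets of a set with A elements have average size A / 2; the outer factor 2 clears this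
  -- half.
  subsetSum-weight-≥ : ∀ f {us} → AllPairs Nonadjacent us → All (λ u → 1 ≤ f u) us → ∀ W →
    independent W * ((2 * weight f W + available us W) * 2 ^ available us W)
    ≤ 2 * subsetSum us (λ W → independent W * weight f W) W
  subsetSum-weight-≥ f [] [] W = ≤-reflexive (lemma (independent W) (weight f W))
    where
    lemma : ∀ i w → i * ((2 * w + 0) * 1) ≡ 2 * (i * w)
    lemma = solve-∀
  subsetSum-weight-≥ f {u ∷ us} (uz ∷ pairs) (fu≥1 ∷ f≥1) W = begin
    i * ((2 * w + (free u W + A)) * 2 ^ (free u W + A))
      ≤⟨ choose (free-0∨1 u W) ⟩
    free u W * i * ((2 * (f u + w) + A) * 2 ^ A) + i * ((2 * w + A) * 2 ^ A)
      ≡⟨ cong (λ ● → free u W * i * ((2 * (f u + w) + ●) * 2 ^ ●) + i * ((2 * w + A) * 2 ^ A)) (sym (available-∷ W uz)) ⟩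
    independent (u ∷ W) * ((2 * weight f (u ∷ W) + available us (u ∷ W)) * 2 ^ available us (u ∷ W)) + i * ((2 * w + A) * 2 ^ A)
      ≤⟨ +-mono-≤ (subsetSum-weight-≥ f pairs f≥1 (u ∷ W)) (subsetSum-weight-≥ f pairs f≥1 W) ⟩
    2 * subsetSum us F (u ∷ W) + 2 * subsetSum us F W
      ≡⟨ *-distribˡ-+ 2 (subsetSum us F (u ∷ W)) (subsetSum us F W) ⟨
    2 * subsetSum (u ∷ us) F W ∎
    where
    open ≤-Reasoning
    i = independent W
    w = weight f W
    A = available us W
    F : List (Fin n) → ℕ
    F W = independent W * weight f W
    lemma : ∀ i w A e → i * ((2 * w + (1 + A)) * (2 * e)) ≡ 1 * i * ((2 * (1 + w) + A) * e) + i * ((2 * w + A) * e)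
    lemma = solve-∀
    choose : ∀ {k} → k ≡ 0 ⊎ k ≡ 1 → i * ((2 * w + (k + A)) * 2 ^ (k + A))
      ≤ k * i * ((2 * (f u + w) + A) * 2 ^ A) + i * ((2 * w + A) * 2 ^ A)
    choose (inj₁ refl) = ≤-refl
    choose (inj₂ refl) = ≤-trans (≤-reflexive (lemma i w A (2 ^ A)))
      (+-monoˡ-≤ _ (*-monoʳ-≤ (1 * i) (*-monoˡ-≤ (2 ^ A) (+-monoˡ-≤ A (*-monoʳ-≤ 2 (+-monoˡ-≤ w fu≥1))))))

  -- Adding any neighbour of a vertex of `W` destroys independence, so only the empty choice counts.
  subsetSum-blocked : ∀ {v us W} → All (Adj v) us → v ∈ W → subsetSum us independent W ≤ independent W
  subsetSum-blocked [] v∈ = ≤-refl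
  subsetSum-blocked {v} {u ∷ us} {W} (vu ∷ vus) v∈ = begin
    subsetSum us independent (u ∷ W) + subsetSum us independent W
      ≤⟨ +-mono-≤ (subsetSum-blocked vus (there v∈)) (subsetSum-blocked vus v∈) ⟩
    free u W * independent W + independent W
      ≡⟨ cong (λ ● → ● * independent W + independent W) (free-Adj v∈ (Adj-sym vu)) ⟩
    independent W ∎
    where open ≤-Reasoning

  free-all : ∀ {v W} → All (Nonadjacent v) W → free v W ≡ 1
  free-all [] = refl
  free-all (vw ∷ vws) rewrite vw | free-all vws = refl

  δ : Fin n → Fin n → ℕ
  δ u v with u Fin.≟ v
  ... | yes _ = 1
  ... | no  _ = 0

  δ-refl : ∀ v → δ v v ≡ 1
  δ-refl v with v Fin.≟ v
  ... | yes _  = refl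
  ... | no v≢v = contradiction refl v≢v

  δ-≢ : ∀ {u v} → u ≢ v → δ u v ≡ 0
  δ-≢ {u} {v} u≢v with u Fin.≟ v
  ... | yes u≡v = contradiction u≡v u≢v
  ... | no  _   = refl

  weight-δ≤1 : ∀ w {vs} → Unique vs → weight (λ v → δ v w) vs ≤ 1
  weight-δ≤1 w [] = z≤n
  weight-δ≤1 w {v ∷ vs} (v∉ ∷ unique) with v Fin.≟ w
  ... | no  _    = weight-δ≤1 w unique
  ... | yes refl = ≤-reflexive (cong suc (zero-on vs v∉))
    where
    zero-on : ∀ vs → All (v ≢_) vs → weight (λ u → δ u v) vs ≡ 0
    zero-on [] [] = refl
    zero-on (u ∷ vs) (v≢u ∷ v∉) = cong₂ _+_ (δ-≢ (≢-sym v≢u)) (zero-on vs v∉)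

  vertices : List (Fin n)
  vertices = allFin n

  independentSets : ℕ
  independentSets = subsetSum vertices independent []

  module _ (d l : ℕ) (4ˡ≤d : 4 ^ l ≤ d) where

    -- Summed over `w` in a set, this is Alon's weight of `v`: `d` if `v` belongs to the set, plus
    -- the number of neighbours of `v` in it.
    charge : Fin n → Fin n → ℕ
    charge v w = d * δ v w + adjacent v w

    charged : Fin n → List (Fin n) → ℕ
    charged v W = independent W * weight (charge v) W

    -- W \ (N(v) ∪ {v}) is fixed to be H; W is then either H ∪ {v}, or H ∪ T for
    -- an arbitrary set T of the x available neighbours of v.
    fibre : ∀ v {us H} → All (Adj v) us → AllPairs Nonadjacent us → All (Nonadjacent v) H →
      l * subsetSum (v ∷ us) independent H ≤ 2 * subsetSum (v ∷ us) (charged v) H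
    fibre v {us} {H} v-us pairs v-H = begin
      l * (subsetSum us independent (v ∷ H) + subsetSum us independent H)
        ≤⟨ *-monoʳ-≤ l (+-mono-≤ (≤-trans (subsetSum-blocked v-us (here refl)) (≤-reflexive ind-v∷H)) (≤-reflexive (subsetSum-independent pairs H))) ⟩
      l * (i + i * 2 ^ x)
        ≡⟨ e₁ l i (2 ^ x) ⟩
      i * (l + l * 2 ^ x)
        ≤⟨ *-monoʳ-≤ i (fibre-bound l x 4ˡ≤d) ⟩
      i * (2 * d + x * 2 ^ x)
        ≡⟨ e₂ i d (x * 2 ^ x) ⟩
      2 * (i * d) + i * (x * 2 ^ x)
        ≤⟨ +-mono-≤ (*-monoʳ-≤ 2 with-v) without-v ⟩
      2 * subsetSum us (charged v) (v ∷ H) + 2 * subsetSum us (charged v) H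
        ≡⟨ *-distribˡ-+ 2 (subsetSum us (charged v) (v ∷ H)) (subsetSum us (charged v) H) ⟨
      2 * subsetSum (v ∷ us) (charged v) H ∎
      where
      open ≤-Reasoning
      i = independent H
      x = available us H
      e₁ : ∀ l i e → l * (i + i * e) ≡ i * (l + l * e)
      e₁ = solve-∀
      e₂ : ∀ i d k → i * (2 * d + k) ≡ 2 * (i * d) + i * k
      e₂ = solve-∀
      ind-v∷H : independent (v ∷ H) ≡ i
      ind-v∷H = trans (cong (_* i) (free-all v-H)) (*-identityˡ i)
      with-v : i * d ≤ subsetSum us (charged v) (v ∷ H)
      with-v = begin
        i * d                                              ≤⟨ *-monoʳ-≤ i (≤-trans (≤-reflexive (sym (trans (cong (d *_) (δ-refl v)) (*-identityʳ d)))) (≤-trans (m≤m+n _ _) (m≤m+n _ _))) ⟩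
        i * weight (charge v) (v ∷ H)                      ≡⟨ cong (_* weight (charge v) (v ∷ H)) ind-v∷H ⟨
        charged v (v ∷ H)                                  ≤⟨ subsetSum-≥ us (charged v) (v ∷ H) ⟩
        subsetSum us (charged v) (v ∷ H)                   ∎
      without-v : i * (x * 2 ^ x) ≤ 2 * subsetSum us (charged v) H
      without-v = ≤-trans (*-monoʳ-≤ i (*-monoˡ-≤ (2 ^ x) (m≤n+m x (2 * weight (charge v) H))))
        (subsetSum-weight-≥ (charge v) pairs (All.map (λ a → ≤-trans (≤-reflexive (sym (Adj⇒adjacent≡1 a))) (m≤n+m _ _)) v-us) H)

    neighbours-nonadjacent : ∀ v {us} → All (Adj v) us → AllPairs Nonadjacent us
    neighbours-nonadjacent v [] = []
    neighbours-nonadjacent v (vu ∷ v-us) =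
      All.map (λ vw → ¬Adj⇒nonadjacent≡1 (triangle-free vu vw)) v-us ∷ neighbours-nonadjacent v v-us

    -- With the vertices listed as the rest, then `v`, then its neighbours, the sum splits into one
    -- fibre for each choice `H` on the rest, and `fibre` applies to each.
    charged-bound : ∀ v → l * independentSets ≤ 2 * subsetSum vertices (charged v) []
    charged-bound v with ys , zs , eq ← ∈-∃++ (∈-filter⁺ (λ u → ¬? (adj? v u)) (∈-allFin v) Adj-irrefl) = begin
      l * subsetSum vertices independent []
        ≡⟨ cong (l *_) (trans (subsetSum-↭ independent-↭ π []) (subsetSum-++ (ys ++ zs) (v ∷ N) independent [])) ⟩
      l * subsetSum (ys ++ zs) (subsetSum (v ∷ N) independent) []
        ≡⟨ subsetSum-* l (ys ++ zs) (subsetSum (v ∷ N) independent) [] ⟨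
      subsetSum (ys ++ zs) (λ H → l * subsetSum (v ∷ N) independent H) []
        ≤⟨ subsetSum-mono-≤ (λ xs W → All (Nonadjacent v) xs × All (Nonadjacent v) W)
             (λ { (px ∷ pxs , pW) → (pxs , px ∷ pW) , (pxs , pW) })
             (λ (_ , v-H) → fibre v (all-filter (adj? v) vertices) (neighbours-nonadjacent v (all-filter (adj? v) vertices)) v-H)
             (ys ++ zs) (v-rest , []) ⟩
      subsetSum (ys ++ zs) (λ H → 2 * subsetSum (v ∷ N) (charged v) H) []
        ≡⟨ subsetSum-* 2 (ys ++ zs) (subsetSum (v ∷ N) (charged v)) [] ⟩
      2 * subsetSum (ys ++ zs) (subsetSum (v ∷ N) (charged v)) []
        ≡⟨ cong (2 *_) (sym (trans (subsetSum-↭ charged-↭ π []) (subsetSum-++ (ys ++ zs) (v ∷ N) (charged v) []))) ⟩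
      2 * subsetSum vertices (charged v) [] ∎
      where
      open ≤-Reasoning
      N = filter (adj? v) vertices
      charged-↭ : ∀ {W W′} → W ↭ W′ → charged v W ≡ charged v W′
      charged-↭ π = cong₂ _*_ (independent-↭ π) (weight-↭ (charge v) π)
      π : vertices ↭ (ys ++ zs) ++ v ∷ N
      π = ↭-trans (filter-split-↭ (adj? v) vertices)
          (↭-trans (++⁺ʳ N (subst (_↭ v ∷ ys ++ zs) (sym eq) (shift v ys zs)))
                   (↭-sym (shift v (ys ++ zs) N)))
      v-rest : All (Nonadjacent v) (ys ++ zs)
      v-rest with _ ∷ rest ← All-resp-↭ (shift v ys zs) (subst (All (λ u → ¬ Adj v u)) eq (all-filter (λ u → ¬? (adj? v u)) vertices)) =
        All.map ¬Adj⇒nonadjacent≡1 rest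

    -- Summing charged-bound over v: the expected size of a uniformly random
    -- independent set is at least n l / 4 d.
    independence-bound : ∀ α → (∀ v → weight (adjacent v) vertices ≤ d) →
      (∀ W → Unique W → (∀ {u v} → u ∈ W → v ∈ W → ¬ Adj u v) → length W ≤ α) →
      n * l ≤ 4 * (d * α)
    independence-bound α degree≤d size≤α = *-cancelʳ-≤ (n * l) (4 * (d * α)) independentSets {{>-nonZero (subsetSum-≥ vertices independent [])}} (begin
      n * l * I
        ≡⟨ *-assoc n l I ⟩
      n * (l * I)
        ≡⟨ cong (_* (l * I)) (length-tabulate {n = n} (λ u → u)) ⟨
      length vertices * (l * I)
        ≡⟨ weight-const (l * I) vertices ⟨
      weight (λ _ → l * I) vertices
        ≤⟨ weight-mono-≤ charged-bound vertices ⟩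
      weight (λ v → 2 * subsetSum vertices (charged v) []) vertices
        ≡⟨ weight-* 2 (λ v → subsetSum vertices (charged v) []) vertices ⟩
      2 * weight (λ v → subsetSum vertices (charged v) []) vertices
        ≡⟨ cong (2 *_) (subsetSum-weight charged vertices vertices []) ⟩
      2 * subsetSum vertices (λ W → weight (λ v → charged v W) vertices) []
        -- `size≤α` concerns lists without repetition; the invariant records that `W` is one and
        -- avoids the vertices still to come.
        ≤⟨ *-monoʳ-≤ 2 (subsetSum-mono-≤ (λ xs W → Unique xs × Unique W × All (λ x → All (x ≢_) W) xs)
             (λ { (x∉ ∷ xs! , W! , x∉W ∷ xs∉W) → (xs! , x∉W ∷ W! , All.zipWith (λ (x≢z , z∉W) → ≢-sym x≢z ∷ z∉W) (x∉ , xs∉W)) , (xs! , W! , xs∉W) })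
             (λ {W} (_ , W! , _) → total W W!)
             vertices (allFin⁺ n , [] , All.tabulate λ _ → [])) ⟩
      2 * subsetSum vertices (λ W → 2 * d * α * independent W) []
        ≡⟨ cong (2 *_) (subsetSum-* (2 * d * α) vertices independent []) ⟩
      2 * (2 * d * α * I)
        ≡⟨ lemma d α I ⟩
      4 * (d * α) * I ∎)
      where
      open ≤-Reasoning
      I = independentSets
      lemma : ∀ d α I → 2 * (2 * d * α * I) ≡ 4 * (d * α) * I
      lemma = solve-∀
      -- Double counting: `w` receives `d` from itself and 1 from each of its at most `d`
      -- neighbours.
      charge≤2d : ∀ w → weight (λ v → charge v w) vertices ≤ 2 * d
      charge≤2d w = begin
        weight (λ v → d * δ v w + adjacent v w) vertices
          ≡⟨ weight-+ (λ v → d * δ v w) (λ v → adjacent v w) vertices ⟩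
        weight (λ v → d * δ v w) vertices + weight (λ v → adjacent v w) vertices
          ≡⟨ cong₂ _+_ (weight-* d (λ v → δ v w) vertices) (weight-cong (λ v → adjacent-sym v w) vertices) ⟩
        d * weight (λ v → δ v w) vertices + weight (adjacent w) vertices
          ≤⟨ +-mono-≤ (*-monoʳ-≤ d (weight-δ≤1 w (allFin⁺ n))) (degree≤d w) ⟩
        d * 1 + d
          ≡⟨ comm d ⟩
        2 * d ∎
        where
        comm : ∀ d → d * 1 + d ≡ 2 * d
        comm = solve-∀
      total : ∀ W → Unique W → weight (λ v → charged v W) vertices ≤ 2 * d * α * independent W
      total W W! = begin
        weight (λ v → independent W * weight (charge v) W) vertices
          ≡⟨ weight-* (independent W) (λ v → weight (charge v) W) vertices ⟩
        independent W * weight (λ v → weight (charge v) W) vertices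
          ≡⟨ cong (independent W *_) (weight-swap charge vertices W) ⟩
        independent W * weight (λ w → weight (λ v → charge v w) vertices) W
          ≤⟨ *-monoʳ-≤ (independent W) (weight-mono-≤ charge≤2d W) ⟩
        independent W * weight (λ _ → 2 * d) W
          ≡⟨ cong (independent W *_) (weight-const (2 * d) W) ⟩
        independent W * (length W * (2 * d))
          ≤⟨ size ⟩
        independent W * (α * (2 * d))
          ≡⟨ rearrange (independent W) α d ⟩
        2 * d * α * independent W ∎
        where
        rearrange : ∀ i α d → i * (α * (2 * d)) ≡ 2 * d * α * i
        rearrange = solve-∀
        size : independent W * (length W * (2 * d)) ≤ independent W * (α * (2 * d))
        size with independent W ≟ 0
        ... | yes eq rewrite eq = z≤n
        ... | no  ind≢0 = *-monoʳ-≤ (independent W) (*-monoˡ-≤ (2 * d) (size≤α W W! (independent⇒¬Adj ind≢0)))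

-- Bounds on h₂

insert : ∀ {n} (S : Subset n) x → ¬ (x ∈ₛ S) →
         Σ[ T ∈ Subset n ] (∣ T ∣ ≡ suc ∣ S ∣ × (∀ u → u ∈ₛ T → u ≡ x ⊎ u ∈ₛ S))
insert (inside ∷ S) Fin.zero x∉S = contradiction here x∉S
insert (outside ∷ S) Fin.zero x∉S = inside ∷ S , refl , λ { _ here → inj₁ refl ; _ (there u∈) → inj₂ (there u∈) }
insert (outside ∷ S) (Fin.suc x) x∉S with T , ∣T∣ , T⊆ ← insert S x (λ x∈ → x∉S (there x∈)) =
  outside ∷ T , ∣T∣ , λ { _ (there u∈) → [ (λ { refl → inj₁ refl }) , (λ u∈S → inj₂ (there u∈S)) ]′ (T⊆ _ u∈) }
insert (inside ∷ S) (Fin.suc x) x∉S with T , ∣T∣ , T⊆ ← insert S x (λ x∈ → x∉S (there x∈)) =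
  inside ∷ T , cong suc ∣T∣ , λ { _ here → inj₂ here ; _ (there u∈) → [ (λ { refl → inj₁ refl }) , (λ u∈S → inj₂ (there u∈S)) ]′ (T⊆ _ u∈) }

unique⇒subset : ∀ {n} {xs : List (Fin n)} → Unique xs →
                Σ[ S ∈ Subset n ] (∣ S ∣ ≡ length xs × (∀ u → u ∈ₛ S → u ∈ xs))
unique⇒subset {n} [] = ⊥ₛ , ∣⊥∣≡0 n , λ u u∈⊥ → contradiction u∈⊥ ∉⊥
unique⇒subset {xs = x ∷ xs} (x∉ ∷ xs!) with S , ∣S∣ , S⊆ ← unique⇒subset xs!
  with T , ∣T∣ , T⊆ ← insert S x (λ x∈S → All.lookup x∉ (S⊆ x x∈S) refl) =
  T , trans ∣T∣ (cong suc ∣S∣) , λ u u∈T → [ here , (λ u∈S → there (S⊆ u u∈S)) ]′ (T⊆ u u∈T)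

module _ {n} (c : Coloring n) (forb : Forb n rrr-rrb-bby c) {h} (isH₂ : IsH₂Of c h) where

  private
    rr : NoCherry c r r
    rr = proj₁ (Forb⇒noCherry c forb)
    rb : NoCherry c r b
    rb = proj₁ (proj₂ (Forb⇒noCherry c forb))

    Red : Fin n → Fin n → Set
    Red u v = u ≢ v × color c u v ≡ r

    red? : ∀ u v → Dec (Red u v)
    red? u v = ¬? (u Fin.≟ v) ×-dec (color c u v ≟ᶜ r)

    Red-sym : ∀ {u v} → Red u v → Red v u
    Red-sym {u} {v} (u≢v , uv) = ≢-sym u≢v , trans (color-sym c v u) uv

    Red-irrefl : ∀ {u} → ¬ Red u u
    Red-irrefl (u≢u , _) = u≢u refl

    Red-triangle-free : ∀ {u v w} → Red v u → Red v w → ¬ Red u w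
    Red-triangle-free {u} {v} {w} vu (v≢w , vw) (u≢w , uw) with u≢v , uv ← Red-sym vu =
      rr u v w u≢v v≢w u≢w uv vw uw

    open TriangleFree red? Red-sym Red-irrefl Red-triangle-free

    twoColored≤h : ∀ {xs} → Unique xs → ∀ x z →
      (∀ {u v} → u ∈ xs → v ∈ xs → u ≢ v → color c u v ≡ x ⊎ color c u v ≡ z) → length xs ≤ h
    twoColored≤h xs! x z colors with S , ∣S∣ , S⊆ ← unique⇒subset xs! =
      proj₂ isH₂ _ (S , ∣S∣ , x , z , λ u v u∈ v∈ → colors (S⊆ u u∈) (S⊆ v v∈))

    independent≤h : ∀ W → Unique W → (∀ {u v} → u ∈ W → v ∈ W → ¬ Red u v) → length W ≤ h
    independent≤h W W! indep = twoColored≤h W! b y colors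
      where
      colors : ∀ {u v} → u ∈ W → v ∈ W → u ≢ v → color c u v ≡ b ⊎ color c u v ≡ y
      colors {u} {v} u∈ v∈ u≢v with color c u v in eq
      ... | r = contradiction (u≢v , eq) (indep u∈ v∈)
      ... | b = inj₁ refl
      ... | y = inj₂ refl

    degree≤h : ∀ v → weight (adjacent v) vertices ≤ h
    degree≤h v = ≤-trans (≤-reflexive (weight-adjacent v vertices))
      (twoColored≤h (filter⁺ (red? v) (allFin⁺ n)) y y colors)
      where
      colors : ∀ {u w} → u ∈ filter (red? v) vertices → w ∈ filter (red? v) vertices → u ≢ w →
               color c u w ≡ y ⊎ color c u w ≡ y
      colors {u} {w} u∈ w∈ u≢w
        with u≢v , uv ← Red-sym (proj₂ (∈-filter⁻ (red? v) {xs = vertices} u∈))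
           | v≢w , vw ← proj₂ (∈-filter⁻ (red? v) {xs = vertices} w∈)
        with color c u w in eq
      ... | r = contradiction eq (rr u v w u≢v v≢w u≢w uv vw)
      ... | b = contradiction eq (rb u v w u≢v v≢w u≢w uv vw)
      ... | y = inj₁ refl

  -- Red degrees and red-independent sets are both bounded by `h`; the maximum with `4 ^ l` only
  -- ensures `4 ^ l ≤ d`.
  h₂-bound : ∀ l → n * l ≤ 4 * ((h ⊔ 4 ^ l) * h)
  h₂-bound l = independence-bound (h ⊔ 4 ^ l) l (m≤n⊔m h (4 ^ l)) h
    (λ v → ≤-trans (degree≤h v) (m≤m⊔n h (4 ^ l))) independent≤h

-- Choice of the parameters

between-powers : ∀ k → 2 ≤ k → ∀ n → 2 ≤ n → ∃[ t ] (k ^ t < n × n ≤ k ^ suc t)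
between-powers k 2≤k (suc zero) (s≤s ())
between-powers k 2≤k (suc (suc zero)) _ = 0 , s≤s (s≤s z≤n) , ≤-trans 2≤k (≤-reflexive (sym (*-identityʳ k)))
between-powers k 2≤k (suc n@(suc (suc _))) _ with t , lo , hi ← between-powers k 2≤k n (s≤s (s≤s z≤n))
  with m≤n⇒m<n∨m≡n hi
... | inj₁ n<  = t , m≤n⇒m≤1+n lo , n<
... | inj₂ n≡ = suc t , s≤s (≤-reflexive (sym n≡)) ,
      ≤-trans (≤-trans (s≤s (≤-reflexive n≡)) (≤-trans (+-monoˡ-≤ P (m^n>0 k (suc t))) (≤-reflexive (double P)))) (*-monoˡ-≤ P 2≤k)
      where
      P = k ^ suc t
      instance _ = >-nonZero (≤-trans (s≤s z≤n) 2≤k)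

-- The number `l` is chosen with `16 ^ (1 + l) < n ≤ 16 ^ (2 + l)`, and 257 = 16² + 1 makes it
-- positive. Then log n ≤ 4 (2 + l) ≤ 12 l, and `4 ^ l ≤ h` turns the maximum in `h₂-bound` into
-- `h`.
h₂-lower : ∀ {n h} → 257 ≤ n → IsH₂ n rrr-rrb-bby h →
  ∃[ l ] (1 ≤ l × n ≤ 2 ^ (12 * l) × n * (12 * l) ≤ 48 * (h * h))
h₂-lower {n} {h} 257≤n ((c , forb , isH₂) , _) with between-powers 16 (s≤s (s≤s z≤n)) n (≤-trans (m≤m+n 2 255) 257≤n)
... | zero , _ , hi = contradiction (≤-trans 257≤n hi) (<⇒≱ (m≤m+n 17 240))
... | suc zero , _ , hi = contradiction (≤-trans 257≤n hi) (<⇒≱ ≤-refl)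
... | suc (suc l′) , lo , hi = l , s≤s z≤n ,
      (begin
        n                       ≤⟨ hi ⟩
        16 ^ (2 + l)            ≡⟨ ^-*-assoc 2 4 (2 + l) ⟩
        2 ^ (4 * (2 + l))       ≤⟨ ^-monoʳ-≤ 2 {4 * (2 + l)} {12 * l} (≤-trans (m≤m+n _ (8 * l′)) (≤-reflexive (e₁ l′))) ⟩
        2 ^ (12 * l)            ∎) ,
      (begin
        n * (12 * l)            ≡⟨ e₂ n l ⟩
        12 * (n * l)            ≤⟨ *-monoʳ-≤ 12 (h₂-bound c forb isH₂ l) ⟩
        12 * (4 * ((h ⊔ 4 ^ l) * h)) ≡⟨ cong (λ ● → 12 * (4 * (● * h))) (m≥n⇒m⊔n≡m 4ˡ≤h) ⟩
        12 * (4 * (h * h))      ≡⟨ *-assoc 12 4 (h * h) ⟨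
        48 * (h * h)            ∎)
  where
  open ≤-Reasoning
  l = suc l′
  e₁ : ∀ l′ → 4 * (2 + suc l′) + 8 * l′ ≡ 12 * suc l′
  e₁ = solve-∀
  e₂ : ∀ n l → n * (12 * l) ≡ 12 * (n * l)
  e₂ = solve-∀
  -- Otherwise `h₂-bound` would give `n ≤ 4 * (4 ^ l * 4 ^ l) ≤ 16 ^ (1 + l)`, against the choice of
  -- `l`.
  4ˡ≤h : 4 ^ l ≤ h
  4ˡ≤h with 4 ^ l ≤? h
  ... | yes le = le
  ... | no  gt = contradiction lo (≤⇒≯ (begin
    n                            ≤⟨ m≤m*n n l ⟩
    n * l                        ≤⟨ h₂-bound c forb isH₂ l ⟩
    4 * ((h ⊔ 4 ^ l) * h)        ≡⟨ cong (λ ● → 4 * (● * h)) (m≤n⇒m⊔n≡n (≰⇒≥ gt)) ⟩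
    4 * (4 ^ l * h)              ≤⟨ *-monoʳ-≤ 4 (*-monoʳ-≤ (4 ^ l) (≰⇒≥ gt)) ⟩
    4 * (4 ^ l * 4 ^ l)          ≤⟨ *-monoˡ-≤ (4 ^ l * 4 ^ l) (m≤m+n 4 12) ⟩
    16 * (4 ^ l * 4 ^ l)         ≡⟨ cong (16 *_) (^-distribʳ-* l 4 4) ⟨
    16 * 16 ^ l                  ∎))
    where
    ^-distribʳ-* : ∀ k i j → (i * j) ^ k ≡ i ^ k * j ^ k
    ^-distribʳ-* zero i j = refl
    ^-distribʳ-* (suc k) i j = trans (cong (i * j *_) (^-distribʳ-* k i j)) (e₃ i j (i ^ k) (j ^ k))
      where
      e₃ : ∀ i j p q → i * j * (p * q) ≡ i * p * (j * q)
      e₃ = solve-∀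

-- In exponents of 2 this compares 6 + 6 t with 30 + 6 t. The slack costs only a constant factor.
≤-cube : ∀ t {n p} → n ≤ 64 ^ suc t → 2 ^ (2 * (5 + t)) < p → n ≤ p * (p * p)
≤-cube t {n} {p} hi x<p = begin
  n                             ≤⟨ hi ⟩
  64 ^ suc t                    ≡⟨ ^-*-assoc 2 6 (suc t) ⟩
  2 ^ (6 * suc t)               ≤⟨ ^-monoʳ-≤ 2 {6 * suc t} {X + (X + X)} (≤-trans (m≤m+n (6 * suc t) 24) (≤-reflexive (e₂ t))) ⟩
  2 ^ (X + (X + X))             ≡⟨ trans (^-distribˡ-+-* 2 X (X + X)) (cong (2 ^ X *_) (^-distribˡ-+-* 2 X X)) ⟩
  2 ^ X * (2 ^ X * 2 ^ X)       ≤⟨ *-mono-≤ (<⇒≤ x<p) (*-mono-≤ (<⇒≤ x<p) (<⇒≤ x<p)) ⟩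
  p * (p * p)                   ∎
  where
  open ≤-Reasoning
  X = 2 * (5 + t)
  e₂ : ∀ t → 6 * suc t + 24 ≡ 2 * (5 + t) + (2 * (5 + t) + 2 * (5 + t))
  e₂ = solve-∀

16^-constant : ∀ e → Σ[ K ∈ ℕ ] (∀ t → 2 * 2 ^ (4 * (e + t)) ≡ K * 16 ^ t)
16^-constant e = 2 * 16 ^ e , λ t → begin
  2 * 2 ^ (4 * (e + t))    ≡⟨ cong (2 *_) (^-*-assoc 2 4 (e + t)) ⟨
  2 * 16 ^ (e + t)         ≡⟨ cong (2 *_) (^-distribˡ-+-* 16 e t) ⟩
  2 * (16 ^ e * 16 ^ t)    ≡⟨ *-assoc 2 (16 ^ e) (16 ^ t) ⟨
  2 * 16 ^ e * 16 ^ t      ∎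
  where open ≡-Reasoning

abstract
  -- The constant is 2 · 16^7, kept opaque because only its existence matters.
  upperConstant : Σ[ K ∈ ℕ ] (∀ t → 2 * 2 ^ (4 * (7 + t)) ≡ K * 16 ^ t)
  upperConstant = 16^-constant 7

2*square-≤ : ∀ {p} e → p ≤ 2 ^ (2 * e) → 2 * (p * p) ≤ 2 * 2 ^ (4 * e)
2*square-≤ {p} e p≤ = *-monoʳ-≤ 2 (begin
  p * p                         ≤⟨ *-mono-≤ p≤ p≤ ⟩
  2 ^ (2 * e) * 2 ^ (2 * e)     ≡⟨ ^-distribˡ-+-* 2 (2 * e) (2 * e) ⟨
  2 ^ (2 * e + 2 * e)           ≡⟨ cong (2 ^_) (*-distribʳ-+ e 2 2) ⟨
  2 ^ (4 * e)                   ∎)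
  where open ≤-Reasoning

coloring⇒h₂≤ : ∀ {n h B} → (Σ[ c ∈ Coloring n ] (Forb n rrr-rrb-bby c × (∀ S → UsesAtMostTwoColors c S → ∣ S ∣ ≤ B))) →
      IsH₂ n rrr-rrb-bby h → h ≤ B
coloring⇒h₂≤ (c , forb , bound) (_ , h-min) with k , isH₂@((S , ∣S∣≡k , two) , _) ← h₂-exists c =
  ≤-trans (h-min k (c , forb , isH₂)) (≤-trans (≤-reflexive (sym ∣S∣≡k)) (bound S two))

-- With `64 ^ t < n ≤ 64 ^ suc t`, the prime from `prime-between t` is of the order of 4^t, hence of
-- n^(1/3). Two-colored sets have at most twice its square many vertices, which is of the order of
-- 16^t.
h₂-upper : ∀ {n h} → 2 ≤ n → IsH₂ n rrr-rrb-bby h → ∃[ t ] (64 ^ t < n × h ≤ proj₁ upperConstant * 16 ^ t)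
h₂-upper {n} 2≤n isH₂ =
  let t , lo , hi = between-powers 64 (s≤s (s≤s z≤n)) n 2≤n
      p , p-prime , x<p , p≤ = prime-between t
  in t , lo , ≤-trans (coloring⇒h₂≤ (prime⇒coloring p-prime (≤-cube t hi x<p)) isH₂)
                      (≤-trans (2*square-≤ (7 + t) p≤) (≤-reflexive (proj₂ upperConstant t)))

-- Translation into Dedekind cuts

ι : ℕ → ℚ
ι n = + n ℚ./ 1

ι≡mkℚ : ∀ n → ι n ≡ mkℚ (+ n) 0 (Coprime.sym (Coprime.1-coprimeTo n))
ι≡mkℚ n = ℚ.normalize-coprime (Coprime.sym (Coprime.1-coprimeTo n))

ι-mono-≤ : ∀ {m n} → m ≤ n → ι m ℚ.≤ ι n
ι-mono-≤ {m} {n} m≤n = subst₂ ℚ._≤_ (sym (ι≡mkℚ m)) (sym (ι≡mkℚ n)) (*≤* (ℤ.*-monoʳ-≤-nonNeg (+ 1) (+≤+ m≤n)))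

ι-mono-< : ∀ {m n} → m < n → ι m ℚ.< ι n
ι-mono-< {m} {n} m<n = subst₂ ℚ._<_ (sym (ι≡mkℚ m)) (sym (ι≡mkℚ n)) (*<* (ℤ.*-monoʳ-<-pos (+ 1) (+<+ m<n)))

ι-* : ∀ m n → ι (m * n) ≡ ι m ℚ.* ι n
ι-* m n = trans (ι≡mkℚ (m * n)) (trans (ℚ.toℚᵘ-injective (ℚᵘ.≃-trans
    (*≡* (cong (ℤ._* + 1) (ℤ.pos-* m n)))
    (ℚᵘ.≃-sym (ℚ.toℚᵘ-homo-* (mkℚ (+ m) 0 (coprime m)) (mkℚ (+ n) 0 (coprime n))))))
  (sym (cong₂ ℚ._*_ (ι≡mkℚ m) (ι≡mkℚ n))))
  where
  coprime : ∀ k → Coprime.Coprime k 1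
  coprime k = Coprime.sym (Coprime.1-coprimeTo k)

0≤ι : ∀ n → 0ℚ ℚ.≤ ι n
0≤ι n = ι-mono-≤ {0} {n} z≤n

ℚ-*-mono-≤ : ∀ {p q s t} → 0ℚ ℚ.≤ p → 0ℚ ℚ.≤ t → p ℚ.≤ q → s ℚ.≤ t → p ℚ.* s ℚ.≤ q ℚ.* t
ℚ-*-mono-≤ {p} {q} {s} {t} 0≤p 0≤t p≤q s≤t = ℚ.≤-trans
  (ℚ.*-monoˡ-≤-nonNeg p {{ℚ.nonNegative 0≤p}} s≤t)
  (ℚ.*-monoʳ-≤-nonNeg t {{ℚ.nonNegative 0≤t}} p≤q)

-- For q = a/d the cut says 2^a < n^d, and n^d ≤ 2^(L d) then gives a < L d.
log-≤ : ∀ {n} L q → n ≤ 2 ^ L → log n q → q ℚ.≤ ι L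
log-≤ {n} L q@(mkℚ a d-1 _) n≤2ᴸ (_ , 2ᵃ<nᵈ) = subst (q ℚ.≤_) (sym (ι≡mkℚ L)) (*≤* (begin
  a ℤ.* + 1            ≡⟨ ℤ.*-identityʳ a ⟩
  a                    ≤⟨ i≤∣i∣ a ⟩
  + ℤ.∣ a ∣            ≤⟨ +≤+ (<⇒≤ (^-monoʳ-<⁻¹ (<-≤-trans 2ᵃ<nᵈ nᵈ≤))) ⟩
  + (L * suc d-1)      ≡⟨ ℤ.pos-* L (suc d-1) ⟩
  + L ℤ.* + suc d-1    ∎))
  where
  open ℤ.≤-Reasoning
  i≤∣i∣ : ∀ i → i ℤ.≤ + ℤ.∣ i ∣
  i≤∣i∣ (+ n)    = ℤ.≤-refl
  i≤∣i∣ -[1+ n ] = -≤+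
  nᵈ≤ : n ^ suc d-1 ≤ 2 ^ (L * suc d-1)
  nᵈ≤ = ≤-trans (^-monoˡ-≤ (suc d-1) n≤2ᴸ) (≤-reflexive (^-*-assoc 2 L (suc d-1)))

-- An element `q` of the left cut that is at least h would yield some `t` with 7 h ≤ t and t² < n ·
-- 12 l ≤ 48 h², which is impossible.
isΩ-√[n·log] : ∀ {h : ℕ → ℕ} →
  (∀ n → 257 ≤ n → ∃[ l ] (1 ≤ l × n ≤ 2 ^ (12 * l) × n * (12 * l) ≤ 48 * (h n * h n))) →
  h isΩ (λ n → √ (fromℕ n · log n))
isΩ-√[n·log] {h} bound = c , _ , 257 , below
  where
  -- 7 is the least integer whose square is at least 48.
  c = + 1 ℚ./ 7
  below : ∀ n → 257 ≤ n → fromℚ c · √ (fromℕ n · log n) ≤ᵣ fromℕ (h n)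
  below n 257≤n {q} (0≤q , s , t , (0≤s , s<c) , (0≤t , 0≤t² , s′ , t′ , (0≤s′ , s′<n) , log-t′ , t²≤) , q≤st)
    with l , 1≤l , n≤ , n12l≤ ← bound n 257≤n with q ℚ.<? ι (h n)
  ... | yes q<h = 0≤q , q<h
  ... | no  q≮h = contradiction loop (ℚ.<-irrefl refl)
    where
    open ℚ.≤-Reasoning
    H = ι (h n)
    L = 12 * l
    7s≤1 : ι 7 ℚ.* s ℚ.≤ 1ℚ
    7s≤1 = ℚ.*-monoˡ-≤-nonNeg (ι 7) (ℚ.<⇒≤ s<c)
    7H≤t : ι 7 ℚ.* H ℚ.≤ t
    7H≤t = begin
      ι 7 ℚ.* H             ≤⟨ ℚ.*-monoˡ-≤-nonNeg (ι 7) (ℚ.≤-trans (ℚ.≮⇒≥ q≮h) q≤st) ⟩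
      ι 7 ℚ.* (s ℚ.* t)     ≡⟨ ℚ.*-assoc (ι 7) s t ⟨
      ι 7 ℚ.* s ℚ.* t       ≤⟨ ℚ.*-monoʳ-≤-nonNeg t {{ℚ.nonNegative 0≤t}} 7s≤1 ⟩
      1ℚ ℚ.* t              ≡⟨ ℚ.*-identityˡ t ⟩
      t                     ∎
    0≤7H : 0ℚ ℚ.≤ ι 7 ℚ.* H
    0≤7H = subst (0ℚ ℚ.≤_) (ι-* 7 (h n)) (0≤ι (7 * h n))
    49h² : ι ((7 * h n) * (7 * h n)) ≡ (ι 7 ℚ.* H) ℚ.* (ι 7 ℚ.* H)
    49h² = trans (ι-* (7 * h n) (7 * h n)) (cong₂ ℚ._*_ (ι-* 7 (h n)) (ι-* 7 (h n)))
    48≤49 : ∀ k → 48 * (k * k) ≤ (7 * k) * (7 * k)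
    48≤49 k = ≤-trans (m≤n+m _ (k * k)) (≤-reflexive (lemma k))
      where
      lemma : ∀ k → k * k + 48 * (k * k) ≡ (7 * k) * (7 * k)
      lemma = solve-∀
    loop : (ι 7 ℚ.* H) ℚ.* (ι 7 ℚ.* H) ℚ.< (ι 7 ℚ.* H) ℚ.* (ι 7 ℚ.* H)
    loop = begin-strict
      (ι 7 ℚ.* H) ℚ.* (ι 7 ℚ.* H)   ≤⟨ ℚ-*-mono-≤ 0≤7H 0≤t 7H≤t 7H≤t ⟩
      t ℚ.* t                       ≡⟨ cong (t ℚ.*_) (ℚ.*-identityʳ t) ⟨
      t ℚ.* (t ℚ.* 1ℚ)              ≤⟨ t²≤ ⟩
      s′ ℚ.* t′                     ≤⟨ ℚ.*-monoˡ-≤-nonNeg s′ {{ℚ.nonNegative 0≤s′}} (log-≤ L t′ n≤ log-t′) ⟩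
      s′ ℚ.* ι L                    <⟨ ℚ.*-monoˡ-<-pos (ι L) {{ℚ.positive (ι-mono-< {0} {L} (*-mono-≤ {1} {12} (s≤s z≤n) 1≤l))}} s′<n ⟩
      ι n ℚ.* ι L                   ≡⟨ ι-* n L ⟨
      ι (n * L)                     ≤⟨ ι-mono-≤ (≤-trans n12l≤ (48≤49 (h n))) ⟩
      ι ((7 * h n) * (7 * h n))     ≡⟨ 49h² ⟩
      (ι 7 ℚ.* H) ℚ.* (ι 7 ℚ.* H)   ∎

isO-n^2/3·√log : ∀ {h : ℕ → ℕ} K →
  (∀ n → 3 ≤ n → ∃[ t ] (64 ^ t < n × h n ≤ K * 16 ^ t)) →
  h isO (λ n → n ^2/3 · √ (log n))
isO-n^2/3·√log {h} K bound = ι (suc K) , ℚ.positive (ι-mono-< {0} {suc K} (s≤s z≤n)) , 3 , above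
  where
  above : ∀ n → 3 ≤ n → fromℕ (h n) ≤ᵣ fromℚ (ι (suc K)) · (n ^2/3 · √ (log n))
  above n 3≤n {q} (0≤q , q<h) with t , 64ᵗ<n , h≤ ← bound n 3≤n =
    -- Witnesses for the product of cuts: K lies below K + 1; 16^t lies below n^(2/3), because
    -- (16^t)³ = (64^t)² < n²; and 1 lies below √(log n), because 2 < n.
    0≤q , ι K , u , (0≤ι K , ι-mono-< (n<1+n K)) ,
    (0≤ι (16 ^ t) , u , 1ℚ , (0≤ι (16 ^ t) , subst (0ℚ ℚ.≤_) u³≡ (0≤ι (w * (w * (w * 1)))) , subst (ℚ._< ι (n ^ 2)) u³≡ (ι-mono-< u³<n²)) ,
      (0≤ι 1 , 0≤ι 1 , ≤-trans 3≤n (≤-reflexive (sym (*-identityʳ n)))) , ℚ.≤-reflexive (sym (ℚ.*-identityʳ u))) ,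
    ℚ.≤-trans (ℚ.<⇒≤ q<h) (ℚ.≤-trans (ι-mono-≤ h≤) (ℚ.≤-reflexive (ι-* K (16 ^ t))))
    where
    u = ι (16 ^ t)
    w = 16 ^ t
    u³≡ : ι (w * (w * (w * 1))) ≡ u ℚ.* (u ℚ.* (u ℚ.* 1ℚ))
    u³≡ = trans (ι-* w (w * (w * 1))) (cong (u ℚ.*_) (trans (ι-* w (w * 1)) (cong (u ℚ.*_) (ι-* w 1))))
    u³<n² : w * (w * (w * 1)) < n ^ 2
    u³<n² = begin-strict
      (16 ^ t) ^ 3           ≡⟨ trans (^-*-assoc 16 t 3) (cong (16 ^_) (*-comm t 3)) ⟩
      16 ^ (3 * t)           ≡⟨ ^-*-assoc 16 3 t ⟨
      4096 ^ t               ≡⟨ ^-*-assoc 64 2 t ⟩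
      64 ^ (2 * t)           ≡⟨ trans (cong (64 ^_) (*-comm 2 t)) (sym (^-*-assoc 64 t 2)) ⟩
      (64 ^ t) ^ 2           <⟨ ^-monoˡ-< 2 64ᵗ<n ⟩
      n ^ 2                  ∎
      where open ≤-Reasoning

lemma3p15 : Σ[ h ∈ (ℕ → ℕ) ]
    ( (∀ n → IsH₂ n rrr-rrb-bby (h n))
    × (h isΩ (λ n → √ (fromℕ n · log n)))
    × (h isO (λ n → n ^2/3 · √ (log n))) )
lemma3p15 =
  h ,
  (λ n → proj₂ (h₂-minimum n)) ,
  isΩ-√[n·log] {h} (λ n 257≤n → h₂-lower 257≤n (proj₂ (h₂-minimum n))) ,
  isO-n^2/3·√log {h} (proj₁ upperConstant) (λ n 3≤n → h₂-upper (<⇒≤ 3≤n) (proj₂ (h₂-minimum n)))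
  where
  h : ℕ → ℕ
  h n = proj₁ (h₂-minimum n)
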